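{- Let $S_n$ denote the symmetric group on $[n]=\{1,\dots,n\}$, viewed as a lattice under the right weak order. Then the number of Eeta wins in $S_n$ satisfies $|\mathbf{E}(S_n)| = O(0.95586^n\, n!)$ as $n\to\infty$.
   Context: An inversion of $w\in S_n$ is a pair $(i,j)$ with $1\le i<j\le n$ and $w^{ -1}(i)>w^{ -1}(j)$. The (right) weak order on $S_n$ is defined by $u\le v$ iff every inversion of $u$ is an inversion of $v$; it is a lattice. For a meet-semilattice $L$ (every principal order ideal finite, so $L$ has a minimum $\hat 0$) and $x\in L$, let $\mathrm{cov}_L(x)$ be the set of elements covered by $x$. An Ungar move sends $x$ to $\bigwedge(\{x\}\cup T)$ for some $T\subseteq \mathrm{cov}_L(x)$; it is nontrivial if $T\neq\emptyset$. Let $\mathrm{Ung}(x)$ be the set of elements obtainable from $x$ by one Ungar move. The Ungar game on a finite lattice $L$: starting at the top element $\hat 1$, two players, Atniss (moving first) and Eeta, alternately make nontrivial Ungar moves; the first player unable to do so (i.e. facing $\hat 0$) loses. $L$ is an Atniss win if Atniss has a winning strategy, and an Eeta win otherwise. An element $x\in L$ is an Eeta win (resp. Atniss win) in $L$ if the interval $[\hat 0,x]$ is an Eeta win (resp. Atniss win); equivalently, recursively, $\hat 0$ is an Eeta win, and $x$ is an Atniss win iff some element of $\mathrm{Ung}(x)\setminus\{x\}$ is an Eeta win. $\mathbf{E}(L)$ denotes the set of Eeta wins in $L$. -}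

module Defs where

open import Data.Nat using (ℕ; zero; suc; _*_)
open import Data.Fin using (Fin; _<_)
open import Data.Fin.Permutation using (Permutation′; _⟨$⟩ˡ_; _≈_)
open import Data.List using (List; [])
open import Data.List.Relation.Unary.All using (All)
open import Data.List.Relation.Unary.AllPairs using (AllPairs)
open import Data.Product using (_×_; Σ; ∃)
open import Data.Unit using (⊤)
open import Relation.Nullary using (¬_)
open import Relation.Binary.PropositionalEquality using (_≢_)

-- The symmetric group S_n: permutations w of Fin n (= [n], 0-indexed).
-- w ⟨$⟩ʳ i is w(i), and w ⟨$⟩ˡ i is w⁻¹(i).
S : ℕ → Set
S n = Permutation′ n

Inv : ∀ {n} → S n → Fin n → Fin n → Set
Inv w i j = i < j × (w ⟨$⟩ˡ j) < (w ⟨$⟩ˡ i)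

_≤w_ : ∀ {n} → S n → S n → Set
u ≤w v = ∀ i j → Inv u i j → Inv v i j

_<w_ : ∀ {n} → S n → S n → Set
u <w v = u ≤w v × ¬ (v ≤w u)

Covers : ∀ {n} → S n → S n → Set
Covers x c = c <w x × (∀ z → c <w z → ¬ (z <w x))

IsMeet : ∀ {n} → S n → List (S n) → S n → Set
IsMeet x T y =
  (y ≤w x × All (y ≤w_) T) ×
  (∀ z → z ≤w x → All (z ≤w_) T → z ≤w y)

-- A nontrivial Ungar move from x to y: y = ⋀({x} ∪ T) with T ⊆ cov(x), T ≠ ∅.
-- (T is given as a finite list of covered elements, repetitions harmless.)
UngarMove : ∀ {n} → S n → S n → Set
UngarMove x y = Σ (List _) λ T → (T ≢ []) × All (Covers x) T × IsMeet x T y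

-- Eeta wins with fuel k: correct whenever k ≥ length of the longest chain
-- below x (nontrivial Ungar moves strictly decrease in the weak order).
EetaWinFuel : ∀ {n} → ℕ → S n → Set
EetaWinFuel zero    x = ⊤
EetaWinFuel (suc k) x = ∀ y → UngarMove x y → ¬ EetaWinFuel k y

-- Every chain in S_n has length ≤ n(n-1)/2 ≤ n * n, so fuel n * n suffices.
EetaWin : ∀ {n} → S n → Set
EetaWin {n} x = EetaWinFuel (n * n) x

DistinctEetaWins : ∀ {n} → List (S n) → Set
DistinctEetaWins xs = AllPairs (λ u v → ¬ (u ≈ v)) xs × All EetaWin xs

{-# OPTIONS --safe #-}

-- If y is an Ungar move of x and every nontrivial move from y is also a move from x, then x is an Atniss
-- win by strategy stealing. A nontrivial move reverses runs of chosen descents, so this applies when x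
-- contains consecutively a decreasing block whose left neighbour is smaller and whose right neighbour is
-- larger than the whole block: y reverses the block, and no descent of y meets it. Hence Eeta wins avoid
-- the consecutive patterns 1324 and 14325.
--
-- Let p_n be the probability that a random permutation of length n avoids both. The pattern of the last k
-- entries is uniform and independent of the prefix, so counting the first occurrence by its end and
-- subtracting overlapping pairs of occurrences gives
--   p_n ≤ p_{n-1} - p_{n-4}/24 - p_{n-5}/120 + 2 p_{n-6}/720 + 15 p_{n-7}/5040,
-- while p_n ≥ p_{n-1} - p_{n-4}/24 - p_{n-5}/120 yields 10 p_n ≥ 9 p_{n-1}. Together they force
-- p_n ≤ (24/25) p_{n-1}, and feeding this back into the first inequality gives p_n ≤ 0.9521 p_{n-1}.
module Submission where

open import Defs
open import Data.Nat using (ℕ; _≤_; _*_; _^_; _!)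
open import Data.List using (List; length)
open import Data.Product using (∃₂)
open import Algebra.Properties.CommutativeSemigroup using (interchange; x∙yz≈y∙xz)
open import Data.Bool using (Bool; true; false; not; _∧_; _∨_; T)
open import Data.Bool.Properties using (∨-zeroʳ)
open import Data.Fin using (Fin; toℕ; fromℕ<) renaming (_<_ to _<ᶠ_)
open import Data.Fin.Permutation using (_⟨$⟩ʳ_; _⟨$⟩ˡ_; _∘ₚ_; transpose; inverseˡ; inverseʳ; _≈_)
import Data.Fin.Permutation.Components as PC
open import Data.Fin.Properties using (toℕ-injective; toℕ-fromℕ<; fromℕ<-toℕ; toℕ<n; any?) renaming (_≟_ to _≟ᶠ_; _<?_ to _<?ᶠ_; <⇒≢ to <ᶠ⇒≢)
open import Data.List using ([]; _∷_; _++_; map; concatMap; upTo; allFin)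
open import Data.List.Membership.Propositional using (_∈_)
open import Data.List.Membership.Propositional.Properties using (∈-allFin; ∈-concatMap⁺; ∈-upTo⁺; ∈-∃++; ∈-map⁺; ∈-++⁻; ∈-++⁺ˡ; ∈-++⁺ʳ)
open import Data.List.Properties using (map-upTo; length-map; length-tabulate)
open import Data.List.Relation.Unary.All using (All; []; _∷_)
import Data.List.Relation.Unary.All as All
import Data.List.Relation.Unary.All.Properties as All
open import Data.List.Relation.Unary.AllPairs using (AllPairs; []; _∷_)
import Data.List.Relation.Unary.AllPairs as AllPairs
import Data.List.Relation.Unary.AllPairs.Properties as AllPairs
open import Data.List.Relation.Unary.Any using (here; there)
import Data.List.Relation.Unary.Any as Any
open import Data.Nat using (zero; suc; _+_; _∸_; _<_; _≤?_; _<?_; _≟_; _≤ᵇ_; z≤n; s≤s)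
open import Data.Nat.Properties hiding (_≤?_; _<?_; _≟_)
open import Data.Product using (_×_; _,_; proj₁; proj₂; Σ; ∃; map₁)
open import Data.Sum using (_⊎_; inj₁; inj₂)
open import Data.Unit using (tt)
open import Data.Vec using (Vec; []; _∷_; head; tail) renaming (_++_ to _++ᵛ_)
open import Function using (_∘_; id)
open import Function.Bundles using (mk⇔)
open import Relation.Binary.Definitions using (tri<; tri≈; tri>)
open import Relation.Binary.PropositionalEquality using (_≡_; _≢_; refl; sym; trans; cong; cong₂; subst; subst₂; ≢-sym; module ≡-Reasoning)
open import Relation.Nullary using (¬_; Dec; yes; no; does; contradiction)
open import Relation.Nullary.Decidable using (_×-dec_; ¬?; decidable-stable; does-⇔; dec-true; dec-false; from-yes)

private variable
  A B C : Set
  n : ℕ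

-- Codes and the distribution of relative ranks

-- Avoiding 1324 alone gives a growth ratio of about 0.95585, too close to 0.95586 for crude
-- estimates. The extra pattern 14325 lowers the ratio by several thousandths, which pays for
-- truncated overlaps and for rounded ratios such as 24/25. Independence comes from the encoding. A
-- code entry ranks a position among the earlier ones only, so a code splits into the entries of a
-- prefix and those of the last `k` positions, and avoidance in the prefix is read off from the
-- former. The last `k` entries are then exchanged bijectively for two independent data: the set of
-- values they occupy, as a composition, and the code of their own pattern. A window test that
-- depends only on the pattern can therefore be counted on the finitely many codes of the window
-- length, by evaluation. Probabilities stay natural numbers throughout: all terms of a recursion
-- are brought to the common denominator `n !`.

∑ : List A → (A → ℕ) → ℕ
∑ []       f = 0
∑ (x ∷ xs) f = f x + ∑ xs f

∑-cong : ∀ (xs : List A) {f g : A → ℕ} → (∀ x → f x ≡ g x) → ∑ xs f ≡ ∑ xs g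
∑-cong []       eq = refl
∑-cong (x ∷ xs) eq = cong₂ _+_ (eq x) (∑-cong xs eq)

∑-mono : ∀ (xs : List A) {f g : A → ℕ} → (∀ x → f x ≤ g x) → ∑ xs f ≤ ∑ xs g
∑-mono []       le = z≤n
∑-mono (x ∷ xs) le = +-mono-≤ (le x) (∑-mono xs le)

∑-zero : ∀ (xs : List A) → ∑ xs (λ _ → 0) ≡ 0
∑-zero []       = refl
∑-zero (x ∷ xs) = ∑-zero xs

∑-+ : ∀ (xs : List A) (f g : A → ℕ) → ∑ xs (λ x → f x + g x) ≡ ∑ xs f + ∑ xs g
∑-+ []       f g = refl
∑-+ (x ∷ xs) f g = trans (cong (f x + g x +_) (∑-+ xs f g)) (interchange +-commutativeSemigroup (f x) (g x) _ _)

∑-*ˡ : ∀ (xs : List A) c (f : A → ℕ) → ∑ xs (λ x → c * f x) ≡ c * ∑ xs f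
∑-*ˡ []       c f = sym (*-zeroʳ c)
∑-*ˡ (x ∷ xs) c f = trans (cong (c * f x +_) (∑-*ˡ xs c f)) (sym (*-distribˡ-+ c (f x) _))

∑-*ʳ : ∀ (xs : List A) c (f : A → ℕ) → ∑ xs (λ x → f x * c) ≡ ∑ xs f * c
∑-*ʳ xs c f = trans (∑-cong xs (λ x → *-comm (f x) c)) (trans (∑-*ˡ xs c f) (*-comm c _))

∑-swap : ∀ (xs : List A) (ys : List B) (f : A → B → ℕ) →
         ∑ xs (λ x → ∑ ys (f x)) ≡ ∑ ys (λ y → ∑ xs (λ x → f x y))
∑-swap []       ys f = sym (∑-zero ys)
∑-swap (x ∷ xs) ys f =
  trans (cong (∑ ys (f x) +_) (∑-swap xs ys f)) (sym (∑-+ ys (f x) _))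

∑-++ : ∀ (xs ys : List A) (f : A → ℕ) → ∑ (xs ++ ys) f ≡ ∑ xs f + ∑ ys f
∑-++ []       ys f = refl
∑-++ (x ∷ xs) ys f = trans (cong (f x +_) (∑-++ xs ys f)) (sym (+-assoc (f x) _ _))

∑-map : ∀ (g : A → B) xs (f : B → ℕ) → ∑ (map g xs) f ≡ ∑ xs (f ∘ g)
∑-map g []       f = refl
∑-map g (x ∷ xs) f = cong (f (g x) +_) (∑-map g xs f)

∑-concatMap : ∀ (g : A → List B) xs (f : B → ℕ) → ∑ (concatMap g xs) f ≡ ∑ xs (λ x → ∑ (g x) f)
∑-concatMap g []       f = refl
∑-concatMap g (x ∷ xs) f = trans (∑-++ (g x) _ f) (cong (∑ (g x) f +_) (∑-concatMap g xs f))

∑-bind : ∀ (h : A → B → C) (ys : A → List B) xs (f : C → ℕ) →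
         ∑ (concatMap (λ x → map (h x) (ys x)) xs) f ≡ ∑ xs (λ x → ∑ (ys x) (f ∘ h x))
∑-bind h ys xs f = trans (∑-concatMap _ xs f) (∑-cong xs (λ x → ∑-map (h x) (ys x) f))

∑-upTo-suc : ∀ n (f : ℕ → ℕ) → ∑ (upTo (suc n)) f ≡ f 0 + ∑ (upTo n) (f ∘ suc)
∑-upTo-suc n f =
  cong (f 0 +_) (trans (cong (λ l → ∑ l f) (sym (map-upTo suc n))) (∑-map suc (upTo n) f))

∑-upTo-const : ∀ n c → ∑ (upTo n) (λ _ → c) ≡ n * c
∑-upTo-const zero    c = refl
∑-upTo-const (suc n) c = trans (∑-upTo-suc n _) (cong (c +_) (∑-upTo-const n c))

∑-upTo-+ : ∀ a b (f : ℕ → ℕ) → ∑ (upTo (a + b)) f ≡ ∑ (upTo a) f + ∑ (upTo b) (λ r → f (a + r))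
∑-upTo-+ zero    b f = refl
∑-upTo-+ (suc a) b f = begin
  ∑ (upTo (suc (a + b))) f                                        ≡⟨ ∑-upTo-suc (a + b) f ⟩
  f 0 + ∑ (upTo (a + b)) (f ∘ suc)                                ≡⟨ cong (f 0 +_) (∑-upTo-+ a b (f ∘ suc)) ⟩
  f 0 + (∑ (upTo a) (f ∘ suc) + ∑ (upTo b) (λ r → f (suc a + r))) ≡⟨ sym (+-assoc (f 0) _ _) ⟩
  f 0 + ∑ (upTo a) (f ∘ suc) + ∑ (upTo b) (λ r → f (suc a + r))   ≡⟨ cong (_+ ∑ (upTo b) (λ r → f (suc a + r))) (sym (∑-upTo-suc a f)) ⟩
  ∑ (upTo (suc a)) f + ∑ (upTo b) (λ r → f (suc a + r))           ∎
  where open ≡-Reasoning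

∑-upTo-cong : ∀ n {f g : ℕ → ℕ} → (∀ r → r < n → f r ≡ g r) → ∑ (upTo n) f ≡ ∑ (upTo n) g
∑-upTo-cong zero            eq = refl
∑-upTo-cong (suc n) {f} {g} eq = begin
  ∑ (upTo (suc n)) f         ≡⟨ ∑-upTo-suc n f ⟩
  f 0 + ∑ (upTo n) (f ∘ suc) ≡⟨ cong₂ _+_ (eq 0 (s≤s z≤n)) (∑-upTo-cong n (λ r r<n → eq (suc r) (s≤s r<n))) ⟩
  g 0 + ∑ (upTo n) (g ∘ suc) ≡⟨ sym (∑-upTo-suc n g) ⟩
  ∑ (upTo (suc n)) g         ∎
  where open ≡-Reasoning

splits : ℕ → List (ℕ × ℕ)
splits zero    = (0 , 0) ∷ []
splits (suc m) = (0 , suc m) ∷ map (map₁ suc) (splits m)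

∑-splits-suc : ∀ m (f : ℕ × ℕ → ℕ) →
               ∑ (splits (suc m)) f ≡ f (0 , suc m) + ∑ (splits m) (λ (x , y) → f (suc x , y))
∑-splits-suc m f = cong (f (0 , suc m) +_) (∑-map (map₁ suc) (splits m) f)

∑-splits-cong : ∀ m {f g : ℕ × ℕ → ℕ} → (∀ x y → x + y ≡ m → f (x , y) ≡ g (x , y)) →
                ∑ (splits m) f ≡ ∑ (splits m) g
∑-splits-cong zero            eq = cong (_+ 0) (eq 0 0 refl)
∑-splits-cong (suc m) {f} {g} eq =
  trans (∑-splits-suc m f)
    (trans (cong₂ _+_ (eq 0 (suc m) refl) (∑-splits-cong m (λ x y p → eq (suc x) y (cong suc p))))
      (sym (∑-splits-suc m g)))

∑-upTo-splits : ∀ m (f : ℕ → ℕ → ℕ) →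
                ∑ (upTo (suc m)) (λ r → f r (m ∸ r)) ≡ ∑ (splits m) (λ (x , y) → f x y)
∑-upTo-splits zero    f = refl
∑-upTo-splits (suc m) f =
  trans (∑-upTo-suc (suc m) (λ r → f r (suc m ∸ r)))
    (trans (cong (f 0 (suc m) +_) (∑-upTo-splits m (f ∘ suc))) (sym (∑-splits-suc m _)))

-- Both sides run over the ways to cut `m` into three ordered parts. In `∑-insert` this turns a
-- split of the first gap into the first two parts of a longer composition.
∑-splits-assoc : ∀ m (h : ℕ → ℕ → ℕ → ℕ) →
  ∑ (splits m) (λ (x , y) → ∑ (splits x) (λ (u , v) → h u v y)) ≡
  ∑ (splits m) (λ (u , w) → ∑ (splits w) (λ (v , y) → h u v y))
∑-splits-assoc zero    h = refl
∑-splits-assoc (suc m) h = begin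
  ∑ (splits (suc m)) (λ (x , y) → ∑ (splits x) (λ (u , v) → h u v y))
    ≡⟨ ∑-splits-suc m _ ⟩
  h 0 0 (suc m) + 0 + ∑ (splits m) (λ (x , y) → ∑ (splits (suc x)) (λ (u , v) → h u v y))
    ≡⟨ cong₂ _+_ (+-identityʳ _) (∑-cong (splits m) (λ (x , y) → ∑-splits-suc x _)) ⟩
  h 0 0 (suc m) + ∑ (splits m) (λ (x , y) → h 0 (suc x) y + ∑ (splits x) (λ (u , v) → h (suc u) v y))
    ≡⟨ cong (h 0 0 (suc m) +_) (∑-+ (splits m) _ _) ⟩
  h 0 0 (suc m) + (∑ (splits m) (λ (x , y) → h 0 (suc x) y) +
                   ∑ (splits m) (λ (x , y) → ∑ (splits x) (λ (u , v) → h (suc u) v y)))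
    ≡⟨ sym (+-assoc (h 0 0 (suc m)) _ _) ⟩
  h 0 0 (suc m) + ∑ (splits m) (λ (x , y) → h 0 (suc x) y) +
                   ∑ (splits m) (λ (x , y) → ∑ (splits x) (λ (u , v) → h (suc u) v y))
    ≡⟨ cong₂ _+_ (sym (∑-splits-suc m _)) (∑-splits-assoc m (h ∘ suc)) ⟩
  ∑ (splits (suc m)) (λ (v , y) → h 0 v y) +
    ∑ (splits m) (λ (u , w) → ∑ (splits w) (λ (v , y) → h (suc u) v y))
    ≡⟨ sym (∑-splits-suc m _) ⟩
  ∑ (splits (suc m)) (λ (u , w) → ∑ (splits w) (λ (v , y) → h u v y)) ∎
  where open ≡-Reasoning

comps : ℕ → ℕ → List (List ℕ)
comps zero    m = (m ∷ []) ∷ []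
comps (suc j) m = concatMap (λ (x , y) → map (x ∷_) (comps j y)) (splits m)

∑-comps-suc : ∀ j m (f : List ℕ → ℕ) →
              ∑ (comps (suc j) m) f ≡ ∑ (splits m) (λ (x , y) → ∑ (comps j y) (λ G → f (x ∷ G)))
∑-comps-suc j m f = ∑-bind (λ (x , _) → x ∷_) (λ (_ , y) → comps j y) (splits m) f

-- A list g₀ ∷ g₁ ∷ … ∷ gⱼ ∷ [] describes j chosen values by the numbers gᵢ of unchosen values between
-- them; pos G i is the i-th chosen value. Inserting a new value r shifts the values ≥ r up by one, and
-- rank r G is the index of r among the chosen values. Past its end a list continues with zero gaps,
-- which makes the lemmas on pos hold without range conditions.
rank : ℕ → List ℕ → ℕ
rank r []       = r
rank r (g ∷ gs) with r ≤? g
... | yes _ = 0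
... | no  _ = suc (rank (r ∸ suc g) gs)

insert : ℕ → List ℕ → List ℕ
insert r []       = []
insert r (g ∷ gs) with r ≤? g
... | yes _ = r ∷ (g ∸ r) ∷ gs
... | no  _ = g ∷ insert (r ∸ suc g) gs

pos : List ℕ → ℕ → ℕ
pos []       i       = i
pos (g ∷ gs) zero    = g
pos (g ∷ gs) (suc i) = suc g + pos gs i

pos-≥-head : ∀ g gs i → g ≤ pos (g ∷ gs) i
pos-≥-head g gs zero    = ≤-refl
pos-≥-head g gs (suc i) = ≤-trans (n≤1+n g) (m≤m+n (suc g) _)

≤pos⇒rank≤ : ∀ r G i → r ≤ pos G i → rank r G ≤ i
≤pos⇒rank≤ r []       i       le = le
≤pos⇒rank≤ r (g ∷ gs) i       le with r ≤? g
≤pos⇒rank≤ r (g ∷ gs) i       le | yes _  = z≤n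
≤pos⇒rank≤ r (g ∷ gs) zero    le | no r≰g = contradiction le r≰g
≤pos⇒rank≤ r (g ∷ gs) (suc i) le | no r≰g =
  s≤s (≤pos⇒rank≤ (r ∸ suc g) gs i (m≤n+o⇒m∸n≤o r (suc g) le))

pos<⇒<rank : ∀ r G i → pos G i < r → i < rank r G
pos<⇒<rank r []       i       lt = lt
pos<⇒<rank r (g ∷ gs) i       lt with r ≤? g
pos<⇒<rank r (g ∷ gs) i       lt | yes r≤g =
  contradiction (≤-trans r≤g (pos-≥-head g gs i)) (<⇒≱ lt)
pos<⇒<rank r (g ∷ gs) zero    lt | no _ = s≤s z≤n
pos<⇒<rank r (g ∷ gs) (suc i) lt | no _ =
  s≤s (pos<⇒<rank (r ∸ suc g) gs i (m+n≤o⇒m≤o∸n (suc (pos gs i)) (subst (_≤ r) (cong suc (+-comm (suc g) _)) lt)))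

pos-insert-rank : ∀ r G → pos (insert r G) (rank r G) ≡ r
pos-insert-rank r []       = refl
pos-insert-rank r (g ∷ gs) with r ≤? g
... | yes _   = refl
... | no  r≰g = trans (cong (suc g +_) (pos-insert-rank (r ∸ suc g) gs)) (m+[n∸m]≡n (≰⇒> r≰g))

pos-insert-≥ : ∀ r G i → rank r G ≤ i → pos (insert r G) (suc i) ≡ suc (pos G i)
pos-insert-≥ r []       i       le = refl
pos-insert-≥ r (g ∷ gs) i       le with r ≤? g
pos-insert-≥ r (g ∷ gs) zero    le | yes r≤g = cong suc (m+[n∸m]≡n r≤g)
pos-insert-≥ r (g ∷ gs) (suc i) le | yes r≤g =
  cong suc (trans (+-suc r _) (cong suc (trans (sym (+-assoc r (g ∸ r) _)) (cong (_+ pos gs i) (m+[n∸m]≡n r≤g)))))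
pos-insert-≥ r (g ∷ gs) (suc i) (s≤s le) | no _ =
  trans (cong (suc g +_) (pos-insert-≥ (r ∸ suc g) gs i le)) (+-suc (suc g) _)

pos-insert-< : ∀ r G i → i < rank r G → pos (insert r G) i ≡ pos G i
pos-insert-< r []       i       lt = refl
pos-insert-< r (g ∷ gs) i       lt with r ≤? g
pos-insert-< r (g ∷ gs) zero    lt       | no _ = refl
pos-insert-< r (g ∷ gs) (suc i) (s≤s lt) | no _ = cong (suc g +_) (pos-insert-< (r ∸ suc g) gs i lt)

insert-≤ : ∀ (H : ℕ → List ℕ → ℕ) r g gs → r ≤ g →
           H (rank r (g ∷ gs)) (insert r (g ∷ gs)) ≡ H 0 (r ∷ (g ∸ r) ∷ gs)
insert-≤ H r g gs r≤g with r ≤? g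
... | yes _   = refl
... | no  r≰g = contradiction r≤g r≰g

insert-> : ∀ (H : ℕ → List ℕ → ℕ) r g gs →
           H (rank (suc g + r) (g ∷ gs)) (insert (suc g + r) (g ∷ gs)) ≡ H (suc (rank r gs)) (g ∷ insert r gs)
insert-> H r g gs with suc g + r ≤? g
... | yes le = contradiction le (<⇒≱ (m≤m+n (suc g) r))
... | no  _  rewrite m+n∸m≡n (suc g) r = refl

-- Splitting a gap by inserting r amounts to choosing an index i and a composition with one more part.
∑-insert : ∀ j m (H : ℕ → List ℕ → ℕ) →
  ∑ (comps j m) (λ G → ∑ (upTo (suc (j + m))) (λ r → H (rank r G) (insert r G))) ≡
  ∑ (upTo (suc j)) (λ i → ∑ (comps (suc j) m) (H i))
∑-insert zero m H = begin
  ∑ (upTo (suc m)) (λ r → H (rank r (m ∷ [])) (insert r (m ∷ []))) + 0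
    ≡⟨ cong (_+ 0) (∑-upTo-cong (suc m) (λ r r<sm → insert-≤ H r m [] (≤-pred r<sm))) ⟩
  ∑ (upTo (suc m)) (λ r → H 0 (r ∷ (m ∸ r) ∷ [])) + 0
    ≡⟨ cong (_+ 0) (∑-upTo-splits m (λ x y → H 0 (x ∷ y ∷ []))) ⟩
  ∑ (splits m) (λ (x , y) → H 0 (x ∷ y ∷ [])) + 0
    ≡⟨ cong (_+ 0) (∑-cong (splits m) (λ _ → sym (+-identityʳ _))) ⟩
  ∑ (splits m) (λ (x , y) → H 0 (x ∷ y ∷ []) + 0) + 0
    ≡⟨ cong (_+ 0) (sym (∑-comps-suc 0 m (H 0))) ⟩
  ∑ (comps 1 m) (H 0) + 0 ∎
  where open ≡-Reasoning
∑-insert (suc j) m H = begin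
  ∑ (comps (suc j) m) (λ G → ∑ (upTo (suc (suc j + m))) (λ r → H (rank r G) (insert r G)))
    ≡⟨ ∑-comps-suc j m _ ⟩
  ∑ (splits m) (λ (x , y) → ∑ (comps j y) (λ G →
    ∑ (upTo (suc (suc j + m))) (λ r → H (rank r (x ∷ G)) (insert r (x ∷ G)))))
    ≡⟨ ∑-splits-cong m (λ x y x+y≡m → ∑-cong (comps j y) (λ G → cut x y x+y≡m G)) ⟩
  ∑ (splits m) (λ (x , y) → ∑ (comps j y) (λ G →
    ∑ (splits x) (λ (u , v) → H 0 (u ∷ v ∷ G)) +
    ∑ (upTo (suc (j + y))) (λ r → H (suc (rank r G)) (x ∷ insert r G))))
    ≡⟨ ∑-cong (splits m) (λ (x , y) → trans (∑-+ (comps j y) _ _)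
         (cong₂ _+_ (∑-swap (comps j y) (splits x) _) (∑-insert j y (λ i G → H (suc i) (x ∷ G))))) ⟩
  ∑ (splits m) (λ (x , y) →
    ∑ (splits x) (λ (u , v) → ∑ (comps j y) (λ G → H 0 (u ∷ v ∷ G))) +
    ∑ (upTo (suc j)) (λ i → ∑ (comps (suc j) y) (λ G → H (suc i) (x ∷ G))))
    ≡⟨ ∑-+ (splits m) _ _ ⟩
  ∑ (splits m) (λ (x , y) → ∑ (splits x) (λ (u , v) → ∑ (comps j y) (λ G → H 0 (u ∷ v ∷ G)))) +
  ∑ (splits m) (λ (x , y) → ∑ (upTo (suc j)) (λ i → ∑ (comps (suc j) y) (λ G → H (suc i) (x ∷ G))))
    ≡⟨ cong₂ _+_ (trans (∑-splits-assoc m (λ u v y → ∑ (comps j y) (λ G → H 0 (u ∷ v ∷ G)))) first)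
                 (trans (∑-swap (splits m) (upTo (suc j)) _) (∑-cong (upTo (suc j)) (λ i → sym (∑-comps-suc (suc j) m _)))) ⟩
  ∑ (comps (suc (suc j)) m) (H 0) +
  ∑ (upTo (suc j)) (λ i → ∑ (comps (suc (suc j)) m) (H (suc i)))
    ≡⟨ sym (∑-upTo-suc (suc j) (λ i → ∑ (comps (suc (suc j)) m) (H i))) ⟩
  ∑ (upTo (suc (suc j))) (λ i → ∑ (comps (suc (suc j)) m) (H i)) ∎
  where
  open ≡-Reasoning
  first : ∑ (splits m) (λ (u , w) → ∑ (splits w) (λ (v , y) → ∑ (comps j y) (λ G → H 0 (u ∷ v ∷ G))))
          ≡ ∑ (comps (suc (suc j)) m) (H 0)
  first = trans (∑-cong (splits m) (λ (u , w) → sym (∑-comps-suc j w _))) (sym (∑-comps-suc (suc j) m _))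
  cut : ∀ x y → x + y ≡ m → ∀ G →
    ∑ (upTo (suc (suc j + m))) (λ r → H (rank r (x ∷ G)) (insert r (x ∷ G))) ≡
    ∑ (splits x) (λ (u , v) → H 0 (u ∷ v ∷ G)) +
    ∑ (upTo (suc (j + y))) (λ r → H (suc (rank r G)) (x ∷ insert r G))
  -- The values `r ≤ x` fall into the first gap and split it; the others pass it and are inserted
  -- into `G` after subtracting `suc x`.
  cut x y refl G = begin
    ∑ (upTo (suc (suc j + (x + y)))) K
      ≡⟨ cong (λ t → ∑ (upTo t) K) len ⟩
    ∑ (upTo (suc x + suc (j + y))) K
      ≡⟨ ∑-upTo-+ (suc x) (suc (j + y)) K ⟩
    ∑ (upTo (suc x)) K + ∑ (upTo (suc (j + y))) (λ r → K (suc x + r))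
      ≡⟨ cong₂ _+_ (trans (∑-upTo-cong (suc x) (λ r r<sx → insert-≤ H r x G (≤-pred r<sx)))
                          (∑-upTo-splits x (λ u v → H 0 (u ∷ v ∷ G))))
                   (∑-cong (upTo (suc (j + y))) (λ r → insert-> H r x G)) ⟩
    ∑ (splits x) (λ (u , v) → H 0 (u ∷ v ∷ G)) +
    ∑ (upTo (suc (j + y))) (λ r → H (suc (rank r G)) (x ∷ insert r G)) ∎
    where
    K : ℕ → ℕ
    K r = H (rank r (x ∷ G)) (insert r (x ∷ G))
    len : suc (suc j + (x + y)) ≡ suc x + suc (j + y)
    len = cong suc (trans (cong suc (trans (sym (+-assoc j x y)) (trans (cong (_+ y) (+-comm j x)) (+-assoc x j y)))) (sym (+-suc x (j + y))))

-- A permutation w is encoded by the numbers r_t = #{p < t : w(p) < w(t)} ≤ t, the last position first;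
-- codesFrom m k lists the codes of k further positions after a prefix of length m.
codesFrom : ℕ → (k : ℕ) → List (Vec ℕ k)
codesFrom m zero    = [] ∷ []
codesFrom m (suc k) = concatMap (λ c → map (_∷ c) (upTo (suc (k + m)))) (codesFrom m k)

codes : (k : ℕ) → List (Vec ℕ k)
codes zero    = [] ∷ []
codes (suc k) = concatMap (λ c → map (_∷ c) (upTo (suc k))) (codes k)

∑-codesFrom-suc : ∀ m k (f : Vec ℕ (suc k) → ℕ) →
  ∑ (codesFrom m (suc k)) f ≡ ∑ (codesFrom m k) (λ c → ∑ (upTo (suc (k + m))) (λ r → f (r ∷ c)))
∑-codesFrom-suc m k f = ∑-bind (λ c r → r ∷ c) (λ _ → upTo (suc (k + m))) (codesFrom m k) f

∑-codes-suc : ∀ k (f : Vec ℕ (suc k) → ℕ) →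
  ∑ (codes (suc k)) f ≡ ∑ (codes k) (λ c → ∑ (upTo (suc k)) (λ r → f (r ∷ c)))
∑-codes-suc k f = ∑-bind (λ c r → r ∷ c) (λ _ → upTo (suc k)) (codes k) f

gaps : ∀ {k} → ℕ → Vec ℕ k → List ℕ
gaps m []      = m ∷ []
gaps m (r ∷ c) = insert r (gaps m c)

ranks : ∀ {k} → ℕ → Vec ℕ k → Vec ℕ k
ranks m []      = []
ranks m (r ∷ c) = rank r (gaps m c) ∷ ranks m c

-- The pair (`gaps`, `ranks`) is a bijection onto value sets times patterns, stated as a change of
-- summation variables. Each further entry contributes one use of `∑-insert`.
∑-gaps-ranks : ∀ m k (H : List ℕ → Vec ℕ k → ℕ) →
  ∑ (codesFrom m k) (λ c → H (gaps m c) (ranks m c)) ≡ ∑ (comps k m) (λ G → ∑ (codes k) (H G))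
∑-gaps-ranks m zero    H = sym (+-identityʳ _)
∑-gaps-ranks m (suc k) H = begin
  ∑ (codesFrom m (suc k)) (λ c → H (gaps m c) (ranks m c))
    ≡⟨ ∑-codesFrom-suc m k _ ⟩
  ∑ (codesFrom m k) (λ c → ∑ (upTo (suc (k + m))) (λ r → H (insert r (gaps m c)) (rank r (gaps m c) ∷ ranks m c)))
    ≡⟨ ∑-gaps-ranks m k (λ G q → ∑ (upTo (suc (k + m))) (λ r → H (insert r G) (rank r G ∷ q))) ⟩
  ∑ (comps k m) (λ G → ∑ (codes k) (λ q → ∑ (upTo (suc (k + m))) (λ r → H (insert r G) (rank r G ∷ q))))
    ≡⟨ ∑-swap (comps k m) (codes k) _ ⟩
  ∑ (codes k) (λ q → ∑ (comps k m) (λ G → ∑ (upTo (suc (k + m))) (λ r → H (insert r G) (rank r G ∷ q))))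
    ≡⟨ ∑-cong (codes k) (λ q → ∑-insert k m (λ i G → H G (i ∷ q))) ⟩
  ∑ (codes k) (λ q → ∑ (upTo (suc k)) (λ i → ∑ (comps (suc k) m) (λ G → H G (i ∷ q))))
    ≡⟨ sym (∑-codes-suc k _) ⟩
  ∑ (codes (suc k)) (λ q → ∑ (comps (suc k) m) (λ G → H G q))
    ≡⟨ ∑-swap (codes (suc k)) (comps (suc k) m) _ ⟩
  ∑ (comps (suc k) m) (λ G → ∑ (codes (suc k)) (H G)) ∎
  where open ≡-Reasoning

∑-ranks : ∀ m k (F : Vec ℕ k → ℕ) →
  ∑ (codesFrom m k) (λ c → F (ranks m c)) ≡ ∑ (comps k m) (λ _ → 1) * ∑ (codes k) F
∑-ranks m k F =
  trans (∑-gaps-ranks m k (λ _ → F))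
    (trans (∑-cong (comps k m) (λ _ → sym (*-identityˡ _))) (∑-*ʳ (comps k m) (∑ (codes k) F) (λ _ → 1)))

risingFactorial : ℕ → ℕ → ℕ
risingFactorial m zero    = 1
risingFactorial m (suc k) = suc (k + m) * risingFactorial m k

∑-codesFrom-1 : ∀ m k → ∑ (codesFrom m k) (λ _ → 1) ≡ risingFactorial m k
∑-codesFrom-1 m zero    = refl
∑-codesFrom-1 m (suc k) = begin
  ∑ (codesFrom m (suc k)) (λ _ → 1)
    ≡⟨ ∑-codesFrom-suc m k _ ⟩
  ∑ (codesFrom m k) (λ _ → ∑ (upTo (suc (k + m))) (λ _ → 1))
    ≡⟨ ∑-cong (codesFrom m k) (λ _ → ∑-upTo-const (suc (k + m)) 1) ⟩
  ∑ (codesFrom m k) (λ _ → suc (k + m) * 1)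
    ≡⟨ ∑-*ˡ (codesFrom m k) (suc (k + m)) _ ⟩
  suc (k + m) * ∑ (codesFrom m k) (λ _ → 1)
    ≡⟨ cong (suc (k + m) *_) (∑-codesFrom-1 m k) ⟩
  risingFactorial m (suc k) ∎
  where open ≡-Reasoning

∑-codes-1 : ∀ k → ∑ (codes k) (λ _ → 1) ≡ k !
∑-codes-1 zero    = refl
∑-codes-1 (suc k) = begin
  ∑ (codes (suc k)) (λ _ → 1)                    ≡⟨ ∑-codes-suc k _ ⟩
  ∑ (codes k) (λ _ → ∑ (upTo (suc k)) (λ _ → 1)) ≡⟨ ∑-cong (codes k) (λ _ → ∑-upTo-const (suc k) 1) ⟩
  ∑ (codes k) (λ _ → suc k * 1)                  ≡⟨ ∑-*ˡ (codes k) (suc k) _ ⟩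
  suc k * ∑ (codes k) (λ _ → 1)                  ≡⟨ cong (suc k *_) (∑-codes-1 k) ⟩
  suc k * k !                                    ∎
  where open ≡-Reasoning

-- The number `N` of value sets is a binomial coefficient, but it need not be evaluated: the
-- constant function 1 in place of `F` already gives `N * k ! ≡ risingFactorial m k`.
!*∑-ranks : ∀ m k (F : Vec ℕ k → ℕ) →
  k ! * ∑ (codesFrom m k) (λ c → F (ranks m c)) ≡ risingFactorial m k * ∑ (codes k) F
!*∑-ranks m k F = begin
  k ! * ∑ (codesFrom m k) (λ c → F (ranks m c)) ≡⟨ cong (k ! *_) (∑-ranks m k F) ⟩
  k ! * (N * ∑ (codes k) F)                     ≡⟨ sym (*-assoc (k !) N _) ⟩
  k ! * N * ∑ (codes k) F                       ≡⟨ cong (_* ∑ (codes k) F) (*-comm (k !) N) ⟩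
  N * k ! * ∑ (codes k) F                       ≡⟨ cong (λ t → N * t * ∑ (codes k) F) (sym (∑-codes-1 k)) ⟩
  N * ∑ (codes k) (λ _ → 1) * ∑ (codes k) F     ≡⟨ cong (_* ∑ (codes k) F) (sym (∑-ranks m k (λ _ → 1))) ⟩
  ∑ (codesFrom m k) (λ _ → 1) * ∑ (codes k) F   ≡⟨ cong (_* ∑ (codes k) F) (∑-codesFrom-1 m k) ⟩
  risingFactorial m k * ∑ (codes k) F           ∎
  where
  open ≡-Reasoning
  N = ∑ (comps k m) (λ _ → 1)

-- Pattern tests on consecutive code entries, the last position first. A later position lies below an
-- earlier one iff its code entry is ≤ the entry of the earlier one, raised by one for each smaller value
-- inserted in between.
is213 : ℕ → ℕ → ℕ → Bool
is213 d c b = (c ≤ᵇ b) ∧ not (d ≤ᵇ suc b)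

is3214 : ℕ → ℕ → ℕ → ℕ → Bool
is3214 e d c b = (c ≤ᵇ b) ∧ (d ≤ᵇ c) ∧ not (e ≤ᵇ suc (suc b))

is1324 : ℕ → ℕ → ℕ → ℕ → Bool
is1324 d c b a = is213 d c b ∧ not (c ≤ᵇ a)

is14325 : ℕ → ℕ → ℕ → ℕ → ℕ → Bool
is14325 e d c b a = is3214 e d c b ∧ not (d ≤ᵇ a)

∧-true⁻ : ∀ {x y} → x ∧ y ≡ true → x ≡ true × y ≡ true
∧-true⁻ {true} eq = refl , eq

∧-true⁺ : ∀ {x y} → x ≡ true → y ≡ true → x ∧ y ≡ true
∧-true⁺ refl eq = eq

∨-true⁻ : ∀ {x y} → x ∨ y ≡ true → x ≡ true ⊎ y ≡ true
∨-true⁻ {true}  eq = inj₁ refl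
∨-true⁻ {false} eq = inj₂ eq

∨-true⁺ˡ : ∀ {x y} → x ≡ true → x ∨ y ≡ true
∨-true⁺ˡ refl = refl

∨-true⁺ʳ : ∀ {x y} → y ≡ true → x ∨ y ≡ true
∨-true⁺ʳ {x} refl = ∨-zeroʳ x

≤ᵇ-true⁻ : ∀ {m n} → (m ≤ᵇ n) ≡ true → m ≤ n
≤ᵇ-true⁻ {m} {n} eq = ≤ᵇ⇒≤ m n (subst T (sym eq) tt)

≤ᵇ-true⁺ : ∀ {m n} → m ≤ n → (m ≤ᵇ n) ≡ true
≤ᵇ-true⁺ {m} {n} le with m ≤ᵇ n in eq
... | true  = refl
... | false = contradiction (≤⇒≤ᵇ le) (subst T eq)

not-≤ᵇ⁻ : ∀ {m n} → not (m ≤ᵇ n) ≡ true → n < m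
not-≤ᵇ⁻ {m} {n} eq with m ≤? n
... | no  m≰n = ≰⇒> m≰n
... | yes m≤n with () ← trans (sym eq) (cong not (≤ᵇ-true⁺ m≤n))

is213⁻ : ∀ {d c b} → is213 d c b ≡ true → c ≤ b × suc b < d
is213⁻ eq = let p , q = ∧-true⁻ eq in ≤ᵇ-true⁻ p , not-≤ᵇ⁻ q

is3214⁻ : ∀ {e d c b} → is3214 e d c b ≡ true → c ≤ b × d ≤ c × suc (suc b) < e
is3214⁻ {e} {d} {c} {b} eq =
  let p , q = ∧-true⁻ {c ≤ᵇ b} eq
      r , s = ∧-true⁻ {d ≤ᵇ c} q
  in ≤ᵇ-true⁻ p , ≤ᵇ-true⁻ r , not-≤ᵇ⁻ s

is1324⁻ : ∀ {d c b a} → is1324 d c b a ≡ true → a < c × c ≤ b × suc b < d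
is1324⁻ {d} {c} {b} eq = let p , q = ∧-true⁻ {is213 d c b} eq in not-≤ᵇ⁻ q , is213⁻ p

is14325⁻ : ∀ {e d c b a} → is14325 e d c b a ≡ true → a < d × c ≤ b × d ≤ c × suc (suc b) < e
is14325⁻ {e} {d} {c} {b} eq = let p , q = ∧-true⁻ {is3214 e d c b} eq in not-≤ᵇ⁻ q , is3214⁻ p

-- The shifts built into a later test of a pattern are correct only if the earlier tests succeed, so
-- its invariance is available only under that assumption.
∧-cong-guarded : ∀ {x x′ y y′} → x ≡ x′ → (x ≡ true → y ≡ y′) → x ∧ y ≡ x′ ∧ y′
∧-cong-guarded {true}  refl eq = eq refl
∧-cong-guarded {false} refl eq = refl

-- Invariance of the pattern tests under passing to relative ranks

record Holds (G : List ℕ) (i v : ℕ) : Set where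
  constructor holds
  field pos≡ : pos G i ≡ v

holds-new : ∀ {G} r → Holds (insert r G) (rank r G) r
holds-new {G} r = holds (pos-insert-rank r G)

≤⇒rank≤ : ∀ {G i v r} → Holds G i v → r ≤ v → rank r G ≤ i
≤⇒rank≤ {G} {i} {r = r} (holds refl) r≤v = ≤pos⇒rank≤ r G i r≤v

≤ᵇ-rank : ∀ {G i v} → Holds G i v → ∀ r → (rank r G ≤ᵇ i) ≡ (r ≤ᵇ v)
≤ᵇ-rank {G} {i} {v} (holds refl) r =
  does-⇔ (mk⇔ to (≤pos⇒rank≤ r G i)) (rank r G ≤? i) (r ≤? v)
  where
  to : rank r G ≤ i → r ≤ v
  to le with r ≤? v
  ... | yes r≤v = r≤v
  ... | no  r≰v = contradiction le (<⇒≱ (pos<⇒<rank r G i (≰⇒> r≰v)))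

holds-above : ∀ {G i v r} → Holds G i v → r ≤ v → Holds (insert r G) (suc i) (suc v)
holds-above {G} {i} {r = r} (holds refl) r≤v = holds (pos-insert-≥ r G i (≤pos⇒rank≤ r G i r≤v))

holds-below : ∀ {G i v r} → Holds G i v → v < r → Holds (insert r G) i v
holds-below {G} {i} {r = r} (holds refl) v<r = holds (pos-insert-< r G i (pos<⇒<rank r G i v<r))

-- The comparison disregards that inserting `b` may push `v` up. This is harmless: if `b ≤ v` then
-- `c ≤ b ≤ v` makes both sides true, and otherwise `v` does not move.
≤ᵇ-rank₂ : ∀ {G i v b c} → Holds G i v → c ≤ b → (rank c (insert b G) ≤ᵇ i) ≡ (c ≤ᵇ v)
≤ᵇ-rank₂ {G} {i} {v} {b} {c} at c≤b with b ≤? v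
... | yes b≤v = trans
  (≤ᵇ-true⁺ {rank c (insert b G)} {i} (≤-trans (≤⇒rank≤ (holds-new {G} b) c≤b) (≤⇒rank≤ at b≤v)))
  (sym (≤ᵇ-true⁺ (≤-trans c≤b b≤v)))
... | no b≰v = ≤ᵇ-rank (holds-below at (≰⇒> b≰v)) c

≤ᵇ-rank₃ : ∀ {G i v b c d} → Holds G i v → c ≤ b → d ≤ c →
           (rank d (insert c (insert b G)) ≤ᵇ i) ≡ (d ≤ᵇ v)
≤ᵇ-rank₃ {G} {i} {v} {b} {c} {d} at c≤b d≤c with b ≤? v
... | yes b≤v = trans
  (≤ᵇ-true⁺ {rank d (insert c (insert b G))} {i}
    (≤-trans (≤⇒rank≤ (holds-new {insert b G} c) d≤c)
      (≤-trans (≤⇒rank≤ (holds-new {G} b) c≤b) (≤⇒rank≤ at b≤v))))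
  (sym (≤ᵇ-true⁺ (≤-trans d≤c (≤-trans c≤b b≤v))))
... | no b≰v = ≤ᵇ-rank₂ (holds-below at (≰⇒> b≰v)) d≤c

is213-rank : ∀ G d c b (let G₁ = insert b G; G₂ = insert c G₁) →
             is213 (rank d G₂) (rank c G₁) (rank b G) ≡ is213 d c b
is213-rank G d c b = ∧-cong-guarded c≤ᵇb λ eq →
  cong not (≤ᵇ-rank (holds-above (holds-new {G} b) (≤ᵇ-true⁻ {c} {b} (trans (sym c≤ᵇb) eq))) d)
  where
  c≤ᵇb = ≤ᵇ-rank (holds-new {G} b) c

is3214-rank : ∀ G e d c b (let G₁ = insert b G; G₂ = insert c G₁; G₃ = insert d G₂) →
              is3214 (rank e G₃) (rank d G₂) (rank c G₁) (rank b G) ≡ is3214 e d c b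
is3214-rank G e d c b = ∧-cong-guarded c≤ᵇb λ eq₁ → ∧-cong-guarded d≤ᵇc λ eq₂ →
  let c≤b = ≤ᵇ-true⁻ {c} {b} (trans (sym c≤ᵇb) eq₁)
      d≤c = ≤ᵇ-true⁻ {d} {c} (trans (sym d≤ᵇc) eq₂)
  in cong not (≤ᵇ-rank (holds-above (holds-above (holds-new {G} b) c≤b)
                         (≤-trans d≤c (≤-trans c≤b (n≤1+n b)))) e)
  where
  c≤ᵇb = ≤ᵇ-rank (holds-new {G} b) c
  d≤ᵇc = ≤ᵇ-rank (holds-new {insert b G} c) d

is1324-rank : ∀ G d c b a (let G₁ = insert a G; G₂ = insert b G₁; G₃ = insert c G₂) →
              is1324 (rank d G₃) (rank c G₂) (rank b G₁) (rank a G) ≡ is1324 d c b a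
is1324-rank G d c b a = ∧-cong-guarded 213≡ λ eq →
  cong not (≤ᵇ-rank₂ (holds-new {G} a) (proj₁ (is213⁻ {d} {c} {b} (trans (sym 213≡) eq))))
  where
  213≡ = is213-rank (insert a G) d c b

is14325-rank : ∀ G e d c b a
               (let G₁ = insert a G; G₂ = insert b G₁; G₃ = insert c G₂; G₄ = insert d G₃) →
               is14325 (rank e G₄) (rank d G₃) (rank c G₂) (rank b G₁) (rank a G) ≡ is14325 e d c b a
is14325-rank G e d c b a = ∧-cong-guarded 3214≡ λ eq →
  let c≤b , d≤c , _ = is3214⁻ {e} {d} {c} {b} (trans (sym 3214≡) eq)
  in cong not (≤ᵇ-rank₃ (holds-new {G} a) c≤b d≤c)
  where
  3214≡ = is3214-rank (insert a G) e d c b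

-- Avoidance of 1324 and 14325

ends1324 : ∀ {n} → Vec ℕ n → Bool
ends1324 (d ∷ c ∷ b ∷ a ∷ _) = is1324 d c b a
ends1324 _                   = false

ends14325 : ∀ {n} → Vec ℕ n → Bool
ends14325 (e ∷ d ∷ c ∷ b ∷ a ∷ _) = is14325 e d c b a
ends14325 _                       = false

bad : ∀ {n} → Vec ℕ n → Bool
bad c = ends1324 c ∨ ends14325 c

avoids : ∀ {n} → Vec ℕ n → Bool
avoids []      = true
avoids (r ∷ c) = not (bad (r ∷ c)) ∧ avoids c

firstBad : ∀ {n} → Vec ℕ (suc n) → Bool
firstBad v = bad v ∧ avoids (tail v)

⟦_⟧ : Bool → ℕ
⟦ true ⟧  = 1
⟦ false ⟧ = 0

⟦⟧≤1 : ∀ x → ⟦ x ⟧ ≤ 1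
⟦⟧≤1 true  = ≤-refl
⟦⟧≤1 false = z≤n

avoiders : ℕ → ℕ
avoiders n = ∑ (codes n) (λ c → ⟦ avoids c ⟧)

firstBads : ℕ → ℕ
firstBads n = ∑ (codes (suc n)) (λ v → ⟦ firstBad v ⟧)

∑-codes-+ : ∀ k m (f : Vec ℕ (k + m) → ℕ) →
            ∑ (codes (k + m)) f ≡ ∑ (codes m) (λ p → ∑ (codesFrom m k) (λ c → f (c ++ᵛ p)))
∑-codes-+ zero    m f = ∑-cong (codes m) (λ p → sym (+-identityʳ (f p)))
∑-codes-+ (suc k) m f = begin
  ∑ (codes (suc (k + m))) f
    ≡⟨ ∑-codes-suc (k + m) f ⟩
  ∑ (codes (k + m)) (λ v → ∑ (upTo (suc (k + m))) (λ r → f (r ∷ v)))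
    ≡⟨ ∑-codes-+ k m _ ⟩
  ∑ (codes m) (λ p → ∑ (codesFrom m k) (λ c → ∑ (upTo (suc (k + m))) (λ r → f (r ∷ (c ++ᵛ p)))))
    ≡⟨ ∑-cong (codes m) (λ p → sym (∑-codesFrom-suc m k (λ c → f (c ++ᵛ p)))) ⟩
  ∑ (codes m) (λ p → ∑ (codesFrom m (suc k)) (λ c → f (c ++ᵛ p))) ∎
  where open ≡-Reasoning

-- scaled n j is (n! / (n - j)!) * avoiders (n - j), so that division by n! gives the avoidance
-- probability at length n - j.
scaled : ℕ → ℕ → ℕ
scaled n       zero    = avoiders n
scaled zero    (suc j) = 0
scaled (suc n) (suc j) = suc n * scaled n j

scaled-+ : ∀ k m → scaled (k + m) k ≡ risingFactorial m k * avoiders m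
scaled-+ zero    m = sym (+-identityʳ _)
scaled-+ (suc k) m = trans (cong (suc (k + m) *_) (scaled-+ k m)) (sym (*-assoc (suc (k + m)) (risingFactorial m k) _))

⟦∧⟧ : ∀ x y → ⟦ x ∧ y ⟧ ≡ ⟦ x ⟧ * ⟦ y ⟧
⟦∧⟧ true  y = sym (+-identityʳ _)
⟦∧⟧ false y = refl

-- The pattern of the last k entries is uniformly distributed and independent of the prefix.
∑-window : ∀ k m (θ : Vec ℕ k → Bool) → (∀ c → θ (ranks m c) ≡ θ c) →
           (f : Vec ℕ (k + m) → ℕ) → (∀ c p → f (c ++ᵛ p) ≡ ⟦ θ c ∧ avoids p ⟧) →
           k ! * ∑ (codes (k + m)) f ≡ ∑ (codes k) (λ c → ⟦ θ c ⟧) * scaled (k + m) k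
∑-window k m θ inv f f≡ = begin
  k ! * ∑ (codes (k + m)) f
    ≡⟨ cong (k ! *_) (∑-codes-+ k m f) ⟩
  k ! * ∑ (codes m) (λ p → ∑ (codesFrom m k) (λ c → f (c ++ᵛ p)))
    ≡⟨ cong (k ! *_) (∑-cong (codes m) λ p →
         trans (∑-cong (codesFrom m k) (λ c → trans (f≡ c p) (⟦∧⟧ (θ c) (avoids p))))
               (∑-*ʳ (codesFrom m k) ⟦ avoids p ⟧ _)) ⟩
  k ! * ∑ (codes m) (λ p → W * ⟦ avoids p ⟧)
    ≡⟨ cong (k ! *_) (∑-*ˡ (codes m) W _) ⟩
  k ! * (W * avoiders m)
    ≡⟨ sym (*-assoc (k !) W _) ⟩
  k ! * W * avoiders m
    ≡⟨ cong (λ t → k ! * t * avoiders m) (∑-cong (codesFrom m k) (λ c → cong ⟦_⟧ (sym (inv c)))) ⟩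
  k ! * ∑ (codesFrom m k) (λ c → ⟦ θ (ranks m c) ⟧) * avoiders m
    ≡⟨ cong (_* avoiders m) (!*∑-ranks m k (λ c → ⟦ θ c ⟧)) ⟩
  risingFactorial m k * P * avoiders m
    ≡⟨ cong (_* avoiders m) (*-comm (risingFactorial m k) P) ⟩
  P * risingFactorial m k * avoiders m
    ≡⟨ *-assoc P (risingFactorial m k) _ ⟩
  P * (risingFactorial m k * avoiders m)
    ≡⟨ cong (P *_) (sym (scaled-+ k m)) ⟩
  P * scaled (k + m) k ∎
  where
  open ≡-Reasoning
  W = ∑ (codesFrom m k) (λ c → ⟦ θ c ⟧)
  P = ∑ (codes k) (λ c → ⟦ θ c ⟧)

window1324 : Vec ℕ 4 → Bool
window1324 (d ∷ c ∷ b ∷ a ∷ []) = is1324 d c b a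

window14325 : Vec ℕ 5 → Bool
window14325 (e ∷ d ∷ c ∷ b ∷ a ∷ []) = is14325 e d c b a

overlap₆ : Vec ℕ 6 → Bool
overlap₆ (f ∷ e ∷ d ∷ c ∷ b ∷ a ∷ []) = is1324 f e d c ∧ is1324 d c b a

-- The overlaps of total length 8 or 9 are truncated to their last seven entries.
overlap₇ : Vec ℕ 7 → Bool
overlap₇ (g ∷ f ∷ e ∷ d ∷ c ∷ b ∷ a ∷ []) =
  (is1324 g f e d ∧ (is14325 e d c b a ∨ (is1324 d c b a ∨ is3214 d c b a))) ∨
  (is14325 g f e d c ∧ ((is1324 d c b a ∨ is3214 d c b a) ∨ is213 c b a))

main₄ : ∀ {m} → Vec ℕ (4 + m) → Bool
main₄ (d ∷ c ∷ b ∷ a ∷ p) = is1324 d c b a ∧ avoids p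

main₅ : ∀ {m} → Vec ℕ (5 + m) → Bool
main₅ (e ∷ d ∷ c ∷ b ∷ a ∷ p) = is14325 e d c b a ∧ avoids p

over₆ : ∀ {m} → Vec ℕ (6 + m) → Bool
over₆ (f ∷ e ∷ d ∷ c ∷ b ∷ a ∷ p) = overlap₆ (f ∷ e ∷ d ∷ c ∷ b ∷ a ∷ []) ∧ avoids p

over₇ : ∀ {m} → Vec ℕ (7 + m) → Bool
over₇ (g ∷ f ∷ e ∷ d ∷ c ∷ b ∷ a ∷ p) = overlap₇ (g ∷ f ∷ e ∷ d ∷ c ∷ b ∷ a ∷ []) ∧ avoids p

-- The factor 1 is the number of codes of length 4 that pass the window test. Here, and for the
-- factors 1, 2 and 15 of the three analogous lemmas, it is found by evaluating the sum over all
-- codes of the window length.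
∑-main₄ : ∀ m → 24 * ∑ (codes (4 + m)) (λ v → ⟦ main₄ v ⟧) ≡ 1 * scaled (4 + m) 4
∑-main₄ m = ∑-window 4 m window1324
  (λ { (d ∷ c ∷ b ∷ a ∷ []) → is1324-rank (gaps m []) d c b a })
  (λ v → ⟦ main₄ v ⟧) (λ { (_ ∷ _ ∷ _ ∷ _ ∷ []) p → refl })

∑-main₅ : ∀ m → 120 * ∑ (codes (5 + m)) (λ v → ⟦ main₅ v ⟧) ≡ 1 * scaled (5 + m) 5
∑-main₅ m = ∑-window 5 m window14325
  (λ { (e ∷ d ∷ c ∷ b ∷ a ∷ []) → is14325-rank (gaps m []) e d c b a })
  (λ v → ⟦ main₅ v ⟧) (λ { (_ ∷ _ ∷ _ ∷ _ ∷ _ ∷ []) p → refl })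

overlap₆-rank : ∀ m c → overlap₆ (ranks m c) ≡ overlap₆ c
overlap₆-rank m (f ∷ e ∷ d ∷ c ∷ b ∷ a ∷ []) =
  cong₂ _∧_ (is1324-rank (gaps m (b ∷ a ∷ [])) f e d c) (is1324-rank (gaps m []) d c b a)

overlap₇-rank : ∀ m c → overlap₇ (ranks m c) ≡ overlap₇ c
overlap₇-rank m (g ∷ f ∷ e ∷ d ∷ c ∷ b ∷ a ∷ []) = cong₂ _∨_
  (cong₂ _∧_ (is1324-rank (gaps m (c ∷ b ∷ a ∷ [])) g f e d)
    (cong₂ _∨_ (is14325-rank (gaps m []) e d c b a) (cong₂ _∨_ 1324≡ 3214≡)))
  (cong₂ _∧_ (is14325-rank (gaps m (b ∷ a ∷ [])) g f e d c)
    (cong₂ _∨_ (cong₂ _∨_ 1324≡ 3214≡) (is213-rank (gaps m []) c b a)))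
  where
  1324≡ = is1324-rank (gaps m []) d c b a
  3214≡ = is3214-rank (gaps m []) d c b a

∑-over₆ : ∀ m → 720 * ∑ (codes (6 + m)) (λ v → ⟦ over₆ v ⟧) ≡ 2 * scaled (6 + m) 6
∑-over₆ m = ∑-window 6 m overlap₆ (overlap₆-rank m)
  (λ v → ⟦ over₆ v ⟧) (λ { (_ ∷ _ ∷ _ ∷ _ ∷ _ ∷ _ ∷ []) p → refl })

∑-over₇ : ∀ m → 5040 * ∑ (codes (7 + m)) (λ v → ⟦ over₇ v ⟧) ≡ 15 * scaled (7 + m) 7
∑-over₇ m = ∑-window 7 m overlap₇ (overlap₇-rank m)
  (λ v → ⟦ over₇ v ⟧) (λ { (_ ∷ _ ∷ _ ∷ _ ∷ _ ∷ _ ∷ _ ∷ []) p → refl })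

-- First occurrences and overlapping pairs of occurrences

⟦true⟧ : ∀ {x} → x ≡ true → 1 ≤ ⟦ x ⟧
⟦true⟧ refl = ≤-refl

avoids-tail : ∀ {n} r (c : Vec ℕ n) → avoids (r ∷ c) ≡ true → avoids c ≡ true
avoids-tail r c = proj₂ ∘ ∧-true⁻ {not (bad (r ∷ c))}

avoids-∷ : ∀ {n} r (c : Vec ℕ n) → avoids c ≡ true → avoids (r ∷ c) ≡ true ⊎ bad (r ∷ c) ≡ true
avoids-∷ r c av with bad (r ∷ c)
... | true  = inj₂ refl
... | false = inj₁ av

bad⁻ : ∀ {n} (c : Vec ℕ n) → bad c ≡ true → ends1324 c ≡ true ⊎ ends14325 c ≡ true
bad⁻ c = ∨-true⁻ {ends1324 c}

bad⇒1324∨3214 : ∀ {n} d c b a (p : Vec ℕ n) → bad (d ∷ c ∷ b ∷ a ∷ p) ≡ true →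
                is1324 d c b a ∨ is3214 d c b a ≡ true
bad⇒1324∨3214 d c b a p eq with bad⁻ (d ∷ c ∷ b ∷ a ∷ p) eq
bad⇒1324∨3214 d c b a p       eq | inj₁ x = ∨-true⁺ˡ x
bad⇒1324∨3214 d c b a (_ ∷ _) eq | inj₂ x = ∨-true⁺ʳ {is1324 d c b a} (proj₁ (∧-true⁻ {is3214 d c b a} x))

is3214⇒is213 : ∀ c b a x → is3214 c b a x ≡ true → is213 c b a ≡ true
is3214⇒is213 c b a x eq =
  let a≤x , b≤a , ssx<c = is3214⁻ {c} {b} {a} {x} eq
  in ∧-true⁺ (≤ᵇ-true⁺ b≤a) (cong not (≰⇒≤ᵇ (<⇒≱ (≤-<-trans (≤-trans (s≤s a≤x) (n≤1+n _)) ssx<c))))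
  where
  ≰⇒≤ᵇ : ∀ {m n} → ¬ m ≤ n → (m ≤ᵇ n) ≡ false
  ≰⇒≤ᵇ {m} {n} m≰n with m ≤ᵇ n in e
  ... | false = refl
  ... | true  = contradiction (≤ᵇ-true⁻ e) m≰n

-- The last three entries of 1324 and of 14325 both form the pattern 213. When an earlier occurrence
-- reaches back beyond the seven recorded entries, such an ending is all that is kept of it.
bad⇒213 : ∀ {n} c b a (p : Vec ℕ n) → bad (c ∷ b ∷ a ∷ p) ≡ true → is213 c b a ≡ true
bad⇒213 c b a (x ∷ p) eq with bad⁻ (c ∷ b ∷ a ∷ x ∷ p) eq
bad⇒213 c b a (x ∷ p)     eq | inj₁ y = proj₁ (∧-true⁻ {is213 c b a} y)
bad⇒213 c b a (x ∷ _ ∷ _) eq | inj₂ y = is3214⇒is213 c b a x (proj₁ (∧-true⁻ {is3214 c b a x} y))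

bad⇒descent : ∀ {n} d c b a (p : Vec ℕ n) → bad (d ∷ c ∷ b ∷ a ∷ p) ≡ true → c ≤ b × b < d
bad⇒descent d c b a p eq =
  let c≤b , sb<d = is213⁻ {d} {c} {b} (bad⇒213 d c b (a ∷ p) eq) in c≤b , <⇒≤ sb<d

1324-14325-disjoint : ∀ e d c b a → is1324 e d c b ≡ true → ¬ is14325 e d c b a ≡ true
1324-14325-disjoint e d c b a x y =
  let b<d , _           = is1324⁻ {e} {d} {c} {b} x
      _ , c≤b , d≤c , _ = is14325⁻ {e} {d} {c} {b} {a} y
  in <⇒≱ b<d (≤-trans d≤c c≤b)

firstBad≤main : ∀ {m} (v : Vec ℕ (5 + m)) → ⟦ firstBad v ⟧ ≤ ⟦ main₄ v ⟧ + ⟦ main₅ v ⟧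
firstBad≤main v@(e ∷ d ∷ c ∷ b ∷ a ∷ p) with firstBad v in eq
... | false = z≤n
... | true  = cases (bad⁻ v (proj₁ bad,avoids))
  where
  bad,avoids : bad v ≡ true × avoids (d ∷ c ∷ b ∷ a ∷ p) ≡ true
  bad,avoids = ∧-true⁻ {bad v} eq
  av : avoids (a ∷ p) ≡ true
  av = avoids-tail b (a ∷ p) (avoids-tail c (b ∷ a ∷ p)
         (avoids-tail d (c ∷ b ∷ a ∷ p) (proj₂ bad,avoids)))
  cases : is1324 e d c b ≡ true ⊎ is14325 e d c b a ≡ true → 1 ≤ ⟦ main₄ v ⟧ + ⟦ main₅ v ⟧
  cases (inj₁ x) = ≤-trans (⟦true⟧ (∧-true⁺ x av)) (m≤m+n _ _)
  cases (inj₂ x) = ≤-trans (⟦true⟧ (∧-true⁺ x (avoids-tail a p av))) (m≤n+m _ ⟦ main₄ v ⟧)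

module _ {m} (g f e d c b a : ℕ) (p : Vec ℕ m) where

  private
    p₁ : Vec ℕ (1 + m)
    p₁ = a ∷ p
    p₂ : Vec ℕ (2 + m)
    p₂ = b ∷ p₁
    p₃ : Vec ℕ (3 + m)
    p₃ = c ∷ p₂
    p₄ : Vec ℕ (4 + m)
    p₄ = d ∷ p₃
    p₅ : Vec ℕ (5 + m)
    p₅ = e ∷ p₄
    v : Vec ℕ (7 + m)
    v = g ∷ f ∷ p₅

    bound : ℕ
    bound = ⟦ firstBad v ⟧ + (⟦ over₆ v ⟧ + ⟦ over₇ v ⟧)

    by-first : bad v ≡ true → avoids (f ∷ p₅) ≡ true → 1 ≤ bound
    by-first x av = ≤-trans (⟦true⟧ (∧-true⁺ x av)) (m≤m+n _ _)

    by-over₆ : is1324 g f e d ∧ is1324 e d c b ≡ true → avoids p₂ ≡ true → 1 ≤ bound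
    by-over₆ x av = ≤-trans (≤-trans (⟦true⟧ (∧-true⁺ x (avoids-tail b p₁ av)))
                      (m≤m+n _ ⟦ over₇ v ⟧)) (m≤n+m _ ⟦ firstBad v ⟧)

    by-over₇ : overlap₇ (g ∷ f ∷ e ∷ d ∷ c ∷ b ∷ a ∷ []) ≡ true → avoids p₂ ≡ true → 1 ≤ bound
    by-over₇ x av = ≤-trans (≤-trans (⟦true⟧ (∧-true⁺ x (avoids-tail a p (avoids-tail b p₁ av))))
                      (m≤n+m _ ⟦ over₆ v ⟧)) (m≤n+m _ ⟦ firstBad v ⟧)

    after1324 after14325 : Bool
    after1324  = is14325 e d c b a ∨ (is1324 d c b a ∨ is3214 d c b a)
    after14325 = (is1324 d c b a ∨ is3214 d c b a) ∨ is213 c b a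

  -- The end of an earlier occurrence is tried at `d`, `e` and `f` in turn. At `d` and `e` the
  -- overlap is counted by `over₆` or `over₇`. It cannot be at `f`: both patterns end in a descent
  -- followed by an ascent, whereas this window rises from `d` to `e`.
  1324-first-or-overlap : is1324 g f e d ≡ true → avoids p₃ ≡ true → 1 ≤ bound
  1324-first-or-overlap x av₃ with avoids-∷ d p₃ av₃
  ... | inj₂ y = by-over₇ (∨-true⁺ˡ {is1324 g f e d ∧ after1324} (∧-true⁺ x
          (∨-true⁺ʳ {is14325 e d c b a} (bad⇒1324∨3214 d c b a p y)))) (avoids-tail c p₂ av₃)
  ... | inj₁ av₄ with avoids-∷ e p₄ av₄
  ... | inj₂ y = overlapping (bad⁻ p₅ y)
    where
    overlapping : ends1324 p₅ ≡ true ⊎ ends14325 p₅ ≡ true → 1 ≤ bound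
    overlapping (inj₁ z) = by-over₆ (∧-true⁺ x z) (avoids-tail c p₂ av₃)
    overlapping (inj₂ z) = by-over₇ (∨-true⁺ˡ {is1324 g f e d ∧ after1324} (∧-true⁺ x (∨-true⁺ˡ z)))
                             (avoids-tail c p₂ av₃)
  ... | inj₁ av₅ with avoids-∷ f p₅ av₅
  ... | inj₁ av₆ = by-first (∨-true⁺ˡ x) av₆
  ... | inj₂ y =
    let d<f , f≤e , _ = is1324⁻ {g} {f} {e} {d} x
        e≤d , _       = bad⇒descent f e d c p₂ y
    in contradiction e≤d (<⇒≱ (<-≤-trans d<f f≤e))

  -- An earlier occurrence may end at `c` or `d`, giving an overlap of one or two entries counted by
  -- `over₇`. It cannot end at `e` or `f`, because both patterns end in an ascent and the window
  -- descends into these two positions.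
  14325-first-or-overlap : is14325 g f e d c ≡ true → avoids p₂ ≡ true → 1 ≤ bound
  14325-first-or-overlap x av₂ with avoids-∷ c p₂ av₂
  ... | inj₂ y = by-over₇ (∨-true⁺ʳ {is1324 g f e d ∧ after1324} (∧-true⁺ x
          (∨-true⁺ʳ {is1324 d c b a ∨ is3214 d c b a} (bad⇒213 c b a p y)))) av₂
  ... | inj₁ av₃ with avoids-∷ d p₃ av₃
  ... | inj₂ y = by-over₇ (∨-true⁺ʳ {is1324 g f e d ∧ after1324} (∧-true⁺ {y = after14325} x
          (∨-true⁺ˡ (bad⇒1324∨3214 d c b a p y)))) av₂
  ... | inj₁ av₄ with avoids-∷ e p₄ av₄
  ... | inj₂ y =
    let c<f , e≤d , f≤e , _ = is14325⁻ {g} {f} {e} {d} {c} x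
        d≤c , _             = bad⇒descent e d c b p₁ y
    in contradiction d≤c (<⇒≱ (<-≤-trans c<f (≤-trans f≤e e≤d)))
  ... | inj₁ av₅ with avoids-∷ f p₅ av₅
  ... | inj₁ av₆ = by-first (∨-true⁺ʳ {is1324 g f e d} x) av₆
  ... | inj₂ y =
    let _ , e≤d , f≤e , _ = is14325⁻ {g} {f} {e} {d} {c} x
        _ , d<f           = bad⇒descent f e d c p₂ y
    in contradiction (≤-trans f≤e e≤d) (<⇒≱ d<f)

-- The `main` tests demand avoidance only before the window, `firstBad` demands it up to the last
-- entry. The difference is an earlier occurrence ending inside the window.
main≤ : ∀ {m} (v : Vec ℕ (7 + m)) →
        ⟦ main₄ v ⟧ + ⟦ main₅ v ⟧ ≤ ⟦ firstBad v ⟧ + (⟦ over₆ v ⟧ + ⟦ over₇ v ⟧)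
main≤ v@(g ∷ f ∷ e ∷ d ∷ c ∷ b ∷ a ∷ p) with main₄ v in eq₄ | main₅ v in eq₅
... | false | false = z≤n
... | true  | false = let x , av = ∧-true⁻ {is1324 g f e d} eq₄ in 1324-first-or-overlap g f e d c b a p x av
... | false | true  = let x , av = ∧-true⁻ {is14325 g f e d c} eq₅ in 14325-first-or-overlap g f e d c b a p x av
... | true  | true  = contradiction (proj₁ (∧-true⁻ {is14325 g f e d c} eq₅))
                        (1324-14325-disjoint g f e d c (proj₁ (∧-true⁻ {is1324 g f e d} eq₄)))

-- The recursion for the number of avoiders

avoiders-suc : ∀ n → avoiders (suc n) + firstBads n ≡ scaled (suc n) 1
avoiders-suc n = begin
  avoiders (suc n) + firstBads n
    ≡⟨ sym (∑-+ (codes (suc n)) (λ v → ⟦ avoids v ⟧) (λ v → ⟦ firstBad v ⟧)) ⟩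
  ∑ (codes (suc n)) (λ v → ⟦ avoids v ⟧ + ⟦ firstBad v ⟧)
    ≡⟨ ∑-codes-suc n _ ⟩
  ∑ (codes n) (λ c → ∑ (upTo (suc n)) (λ r → ⟦ avoids (r ∷ c) ⟧ + ⟦ firstBad (r ∷ c) ⟧))
    ≡⟨ ∑-cong (codes n) (λ c → ∑-cong (upTo (suc n)) (λ r → exclusive (bad (r ∷ c)) (avoids c))) ⟩
  ∑ (codes n) (λ c → ∑ (upTo (suc n)) (λ _ → ⟦ avoids c ⟧))
    ≡⟨ ∑-cong (codes n) (λ c → ∑-upTo-const (suc n) ⟦ avoids c ⟧) ⟩
  ∑ (codes n) (λ c → suc n * ⟦ avoids c ⟧)
    ≡⟨ ∑-*ˡ (codes n) (suc n) _ ⟩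
  suc n * avoiders n ∎
  where
  open ≡-Reasoning
  exclusive : ∀ x y → ⟦ not x ∧ y ⟧ + ⟦ x ∧ y ⟧ ≡ ⟦ y ⟧
  exclusive true  y = refl
  exclusive false y = +-identityʳ ⟦ y ⟧

firstBads-≤ : ∀ m → 120 * firstBads (4 + m) ≤ 5 * scaled (5 + m) 4 + scaled (5 + m) 5
firstBads-≤ m = begin
  120 * firstBads (4 + m)               ≤⟨ *-monoʳ-≤ 120 (∑-mono (codes (5 + m)) firstBad≤main) ⟩
  120 * ∑ (codes (5 + m)) (λ v → ⟦ main₄ v ⟧ + ⟦ main₅ v ⟧)
                                        ≡⟨ cong (120 *_) (∑-+ (codes (5 + m)) (λ v → ⟦ main₄ v ⟧) (λ v → ⟦ main₅ v ⟧)) ⟩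
  120 * (M₄ + M₅)                       ≡⟨ *-distribˡ-+ 120 M₄ M₅ ⟩
  120 * M₄ + 120 * M₅                   ≡⟨ cong₂ _+_ (*-assoc 5 24 M₄) (trans (∑-main₅ m) (*-identityˡ _)) ⟩
  5 * (24 * M₄) + scaled (5 + m) 5      ≡⟨ cong (λ t → 5 * t + scaled (5 + m) 5) (trans (∑-main₄ (1 + m)) (*-identityˡ _)) ⟩
  5 * scaled (5 + m) 4 + scaled (5 + m) 5 ∎
  where
  open ≤-Reasoning
  M₄ = ∑ (codes (5 + m)) (λ v → ⟦ main₄ v ⟧)
  M₅ = ∑ (codes (5 + m)) (λ v → ⟦ main₅ v ⟧)

-- Everything is brought to the denominator 5040 = 7!: the coefficients are 5040/24, 5040/120, 2 ·
-- 5040/720 and 15.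
main-arith : ∀ m₄ m₅ f o₆ o₇ {x₄ x₅ x₆ x₇} → m₄ + m₅ ≤ f + (o₆ + o₇) →
             24 * m₄ ≡ 1 * x₄ → 120 * m₅ ≡ 1 * x₅ → 720 * o₆ ≡ 2 * x₆ → 5040 * o₇ ≡ 15 * x₇ →
             210 * x₄ + 42 * x₅ ≤ 5040 * f + (14 * x₆ + 15 * x₇)
main-arith m₄ m₅ f o₆ o₇ {x₄} {x₅} {x₆} {x₇} le eq₄ eq₅ eq₆ eq₇ = begin
  210 * x₄ + 42 * x₅
    ≡⟨ cong₂ (λ s t → 210 * s + 42 * t) (sym (trans eq₄ (*-identityˡ x₄))) (sym (trans eq₅ (*-identityˡ x₅))) ⟩
  210 * (24 * m₄) + 42 * (120 * m₅)
    ≡⟨ cong₂ _+_ (sym (*-assoc 210 24 m₄)) (sym (*-assoc 42 120 m₅)) ⟩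
  5040 * m₄ + 5040 * m₅
    ≡⟨ sym (*-distribˡ-+ 5040 m₄ m₅) ⟩
  5040 * (m₄ + m₅)
    ≤⟨ *-monoʳ-≤ 5040 le ⟩
  5040 * (f + (o₆ + o₇))
    ≡⟨ trans (*-distribˡ-+ 5040 f (o₆ + o₇)) (cong (5040 * f +_) (*-distribˡ-+ 5040 o₆ o₇)) ⟩
  5040 * f + (5040 * o₆ + 5040 * o₇)
    ≡⟨ cong (5040 * f +_) (cong₂ _+_
         (trans (*-assoc 7 720 o₆) (trans (cong (7 *_) eq₆) (sym (*-assoc 7 2 x₆)))) eq₇) ⟩
  5040 * f + (14 * x₆ + 15 * x₇) ∎
  where open ≤-Reasoning

∑-main≤ : ∀ m (let L = codes (7 + m)) →
  ∑ L (λ v → ⟦ main₄ v ⟧) + ∑ L (λ v → ⟦ main₅ v ⟧) ≤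
  firstBads (6 + m) + (∑ L (λ v → ⟦ over₆ v ⟧) + ∑ L (λ v → ⟦ over₇ v ⟧))
∑-main≤ m = subst₂ _≤_
  (∑-+ L (λ v → ⟦ main₄ v ⟧) (λ v → ⟦ main₅ v ⟧))
  (trans (∑-+ L (λ v → ⟦ firstBad v ⟧) (λ v → ⟦ over₆ v ⟧ + ⟦ over₇ v ⟧))
         (cong (firstBads (6 + m) +_) (∑-+ L (λ v → ⟦ over₆ v ⟧) (λ v → ⟦ over₇ v ⟧))))
  (∑-mono L main≤)
  where
  L = codes (7 + m)

≤-firstBads : ∀ m (let X = scaled (7 + m)) →
  210 * X 4 + 42 * X 5 ≤ 5040 * firstBads (6 + m) + (14 * X 6 + 15 * X 7)
≤-firstBads m = main-arith
  (∑ L (λ v → ⟦ main₄ v ⟧)) (∑ L (λ v → ⟦ main₅ v ⟧)) (firstBads (6 + m))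
  (∑ L (λ v → ⟦ over₆ v ⟧)) (∑ L (λ v → ⟦ over₇ v ⟧))
  {X 4} {X 5} {X 6} {X 7} (∑-main≤ m)
  (∑-main₄ (3 + m)) (∑-main₅ (2 + m)) (∑-over₆ (1 + m)) (∑-over₇ m)
  where
  X = scaled (7 + m)
  L = codes (7 + m)

-- Ratios of avoidance probabilities at consecutive lengths

ratio-trans : ∀ a b c d {x y z} → a * x ≤ b * y → c * y ≤ d * z → (a * c) * x ≤ (b * d) * z
ratio-trans a b c d {x} {y} {z} ax≤by cy≤dz = begin
  (a * c) * x ≡⟨ *-assoc a c x ⟩
  a * (c * x) ≡⟨ x∙yz≈y∙xz *-commutativeSemigroup a c x ⟩
  c * (a * x) ≤⟨ *-monoʳ-≤ c ax≤by ⟩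
  c * (b * y) ≡⟨ x∙yz≈y∙xz *-commutativeSemigroup c b y ⟩
  b * (c * y) ≤⟨ *-monoʳ-≤ b cy≤dz ⟩
  b * (d * z) ≡⟨ sym (*-assoc b d z) ⟩
  (b * d) * z ∎
  where open ≤-Reasoning

-- Both sides gain the same factor (n+1)⋯(n+j), so a ratio found at length `n` can be used over the
-- denominator of length `j + n`.
scaled-shift : ∀ c d i k n j → c * scaled n i ≤ d * scaled n k →
               c * scaled (j + n) (j + i) ≤ d * scaled (j + n) (j + k)
scaled-shift c d i k n zero    le = le
scaled-shift c d i k n (suc j) le = begin
  c * (suc (j + n) * scaled (j + n) (j + i)) ≡⟨ x∙yz≈y∙xz *-commutativeSemigroup c (suc (j + n)) _ ⟩
  suc (j + n) * (c * scaled (j + n) (j + i)) ≤⟨ *-monoʳ-≤ (suc (j + n)) (scaled-shift c d i k n j le) ⟩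
  suc (j + n) * (d * scaled (j + n) (j + k)) ≡⟨ x∙yz≈y∙xz *-commutativeSemigroup (suc (j + n)) d _ ⟩
  d * (suc (j + n) * scaled (j + n) (j + k)) ∎
  where open ≤-Reasoning

scaled-mono : ∀ n j → scaled (suc j + n) j ≤ scaled (suc j + n) (suc j)
scaled-mono n zero    = subst (avoiders (suc n) ≤_) (avoiders-suc n) (m≤m+n _ _)
scaled-mono n (suc j) = *-monoʳ-≤ (suc (suc j + n)) (scaled-mono n j)

lower-arith : ∀ x₀ f x₁ x₄ x₅ → x₀ + f ≡ x₁ → 120 * f ≤ 5 * x₄ + x₅ →
              729 * x₄ ≤ 1000 * x₁ → 6561 * x₅ ≤ 10000 * x₁ → 9 * x₁ ≤ 10 * x₀
lower-arith x₀ f x₁ x₄ x₅ split f≤ x₄≤ x₅≤ = +-cancelˡ-≤ x₁ (9 * x₁) (10 * x₀) (begin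
  10 * x₁          ≡⟨ cong (10 *_) (sym split) ⟩
  10 * (x₀ + f)    ≡⟨ *-distribˡ-+ 10 x₀ f ⟩
  10 * x₀ + 10 * f ≤⟨ +-monoʳ-≤ (10 * x₀) 10f≤x₁ ⟩
  10 * x₀ + x₁     ≡⟨ +-comm (10 * x₀) x₁ ⟩
  x₁ + 10 * x₀     ∎)
  where
  open ≤-Reasoning
  -- The hypotheses give f ≤ (5 (10/9)³ + (10/9)⁴) x₁ / 120, about 0.07 x₁. The factor 6561 = 9⁴
  -- clears denominators, and 78732 = 12 · 6561.
  10f≤x₁ : 10 * f ≤ x₁
  10f≤x₁ = *-cancelˡ-≤ 78732 (begin
    78732 * (10 * f)                  ≡⟨ sym (*-assoc 78732 10 f) ⟩
    787320 * f                        ≡⟨ *-assoc 6561 120 f ⟩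
    6561 * (120 * f)                  ≤⟨ *-monoʳ-≤ 6561 f≤ ⟩
    6561 * (5 * x₄ + x₅)              ≡⟨ *-distribˡ-+ 6561 (5 * x₄) x₅ ⟩
    6561 * (5 * x₄) + 6561 * x₅       ≡⟨ cong (_+ 6561 * x₅) (trans (sym (*-assoc 6561 5 x₄)) (*-assoc 45 729 x₄)) ⟩
    45 * (729 * x₄) + 6561 * x₅       ≤⟨ +-mono-≤ (*-monoʳ-≤ 45 x₄≤) x₅≤ ⟩
    45 * (1000 * x₁) + 10000 * x₁     ≡⟨ cong (_+ 10000 * x₁) (sym (*-assoc 45 1000 x₁)) ⟩
    45000 * x₁ + 10000 * x₁           ≡⟨ sym (*-distribʳ-+ x₁ 45000 10000) ⟩
    55000 * x₁                        ≤⟨ *-monoˡ-≤ x₁ (from-yes (55000 ≤? 78732)) ⟩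
    78732 * x₁                        ∎)

LowerRatio : ℕ → Set
LowerRatio n = 9 * scaled n 1 ≤ 10 * scaled n 0

-- The ratio 9/10 reproduces itself: the four preceding ratios bound `X 4` and `X 5` by (10/9)³ and
-- (10/9)⁴ times `X 1`, as `lower-arith` requires.
lower-step : ∀ m → LowerRatio (1 + m) → LowerRatio (2 + m) → LowerRatio (3 + m) → LowerRatio (4 + m) →
             LowerRatio (5 + m)
lower-step m l₁ l₂ l₃ l₄ =
  lower-arith (X 0) (firstBads (4 + m)) (X 1) (X 4) (X 5) (avoiders-suc (4 + m)) (firstBads-≤ m) 4≤1
    (ratio-trans 9 10 729 1000 {X 5} {X 4} {X 1} (scaled-shift 9 10 1 0 (1 + m) 4 l₁) 4≤1)
  where
  X = scaled (5 + m)
  4≤1 : 729 * X 4 ≤ 1000 * X 1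
  4≤1 = ratio-trans 81 100 9 10 {X 4} {X 2} {X 1}
    (ratio-trans 9 10 9 10 {X 4} {X 3} {X 2} (scaled-shift 9 10 1 0 (2 + m) 3 l₂) (scaled-shift 9 10 1 0 (3 + m) 2 l₃))
    (scaled-shift 9 10 1 0 (4 + m) 1 l₄)

lower-ratio : ∀ n → LowerRatio n
lower-ratio zero                         = z≤n
lower-ratio (suc zero)                   = from-yes (9 * scaled 1 1 ≤? 10 * scaled 1 0)
lower-ratio (suc (suc zero))             = from-yes (9 * scaled 2 1 ≤? 10 * scaled 2 0)
lower-ratio (suc (suc (suc zero)))       = from-yes (9 * scaled 3 1 ≤? 10 * scaled 3 0)
lower-ratio (suc (suc (suc (suc zero)))) = from-yes (9 * scaled 4 1 ≤? 10 * scaled 4 0)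
lower-ratio (suc (suc (suc (suc (suc m))))) =
  lower-step m (lower-ratio (suc m)) (lower-ratio (suc (suc m)))
    (lower-ratio (suc (suc (suc m)))) (lower-ratio (suc (suc (suc (suc m)))))

upper-arith : ∀ x₀ f x₁ x₄ x₅ x₆ x₇ → x₀ + f ≡ x₁ →
              210 * x₄ + 42 * x₅ ≤ 5040 * f + (14 * x₆ + 15 * x₇) →
              81 * x₆ ≤ 100 * x₄ → 729 * x₇ ≤ 1000 * x₄ →
              5040 * x₀ + (170 * x₄ + 42 * x₅) ≤ 5040 * x₁
upper-arith x₀ f x₁ x₄ x₅ x₆ x₇ split ≤f x₆≤ x₇≤ = +-cancelʳ-≤ (40 * x₄) _ _ (begin
  5040 * x₀ + (170 * x₄ + 42 * x₅) + 40 * x₄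
    ≡⟨ +-assoc (5040 * x₀) (170 * x₄ + 42 * x₅) (40 * x₄) ⟩
  5040 * x₀ + (170 * x₄ + 42 * x₅ + 40 * x₄)
    ≡⟨ cong (5040 * x₀ +_) regroup ⟩
  5040 * x₀ + (210 * x₄ + 42 * x₅)
    ≤⟨ +-monoʳ-≤ (5040 * x₀) ≤f ⟩
  5040 * x₀ + (5040 * f + (14 * x₆ + 15 * x₇))
    ≤⟨ +-monoʳ-≤ (5040 * x₀) (+-monoʳ-≤ (5040 * f) overlaps) ⟩
  5040 * x₀ + (5040 * f + 40 * x₄)
    ≡⟨ sym (+-assoc (5040 * x₀) (5040 * f) (40 * x₄)) ⟩
  5040 * x₀ + 5040 * f + 40 * x₄
    ≡⟨ cong (_+ 40 * x₄) (trans (sym (*-distribˡ-+ 5040 x₀ f)) (cong (5040 *_) split)) ⟩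
  5040 * x₁ + 40 * x₄ ∎)
  where
  open ≤-Reasoning
  regroup : 170 * x₄ + 42 * x₅ + 40 * x₄ ≡ 210 * x₄ + 42 * x₅
  regroup = begin-equality
    170 * x₄ + 42 * x₅ + 40 * x₄   ≡⟨ +-assoc (170 * x₄) (42 * x₅) (40 * x₄) ⟩
    170 * x₄ + (42 * x₅ + 40 * x₄) ≡⟨ cong (170 * x₄ +_) (+-comm (42 * x₅) (40 * x₄)) ⟩
    170 * x₄ + (40 * x₄ + 42 * x₅) ≡⟨ sym (+-assoc (170 * x₄) (40 * x₄) (42 * x₅)) ⟩
    170 * x₄ + 40 * x₄ + 42 * x₅   ≡⟨ cong (_+ 42 * x₅) (sym (*-distribʳ-+ x₄ 170 40)) ⟩
    210 * x₄ + 42 * x₅             ∎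
  -- 14 · 100/81 + 15 · 1000/729 is about 37.9; rounding it up to 40 leaves the coefficient 170 =
  -- 210 - 40.
  overlaps : 14 * x₆ + 15 * x₇ ≤ 40 * x₄
  overlaps = *-cancelˡ-≤ 729 (begin
    729 * (14 * x₆ + 15 * x₇)             ≡⟨ *-distribˡ-+ 729 (14 * x₆) (15 * x₇) ⟩
    729 * (14 * x₆) + 729 * (15 * x₇)     ≡⟨ cong₂ _+_ (trans (sym (*-assoc 729 14 x₆)) (*-assoc 126 81 x₆)) (x∙yz≈y∙xz *-commutativeSemigroup 729 15 x₇) ⟩
    126 * (81 * x₆) + 15 * (729 * x₇)     ≤⟨ +-mono-≤ (*-monoʳ-≤ 126 x₆≤) (*-monoʳ-≤ 15 x₇≤) ⟩
    126 * (100 * x₄) + 15 * (1000 * x₄)   ≡⟨ cong₂ _+_ (sym (*-assoc 126 100 x₄)) (sym (*-assoc 15 1000 x₄)) ⟩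
    12600 * x₄ + 15000 * x₄               ≡⟨ sym (*-distribʳ-+ x₄ 12600 15000) ⟩
    27600 * x₄                            ≤⟨ *-monoˡ-≤ x₄ (from-yes (27600 ≤? 29160)) ⟩
    29160 * x₄                            ≡⟨ *-assoc 729 40 x₄ ⟩
    729 * (40 * x₄)                       ∎)

upper : ∀ m (let X = scaled (7 + m)) → 5040 * X 0 + (170 * X 4 + 42 * X 5) ≤ 5040 * X 1
upper m = upper-arith (X 0) (firstBads (6 + m)) (X 1) (X 4) (X 5) (X 6) (X 7)
  (avoiders-suc (6 + m)) (≤-firstBads m) 6≤4
  (ratio-trans 9 10 81 100 {X 7} {X 6} {X 4} (scaled-shift 9 10 1 0 (1 + m) 6 (lower-ratio (1 + m))) 6≤4)
  where
  X = scaled (7 + m)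
  6≤4 : 81 * X 6 ≤ 100 * X 4
  6≤4 = ratio-trans 9 10 9 10 {X 6} {X 5} {X 4}
    (scaled-shift 9 10 1 0 (2 + m) 5 (lower-ratio (2 + m)))
    (scaled-shift 9 10 1 0 (3 + m) 4 (lower-ratio (3 + m)))

-- Probabilities decrease with the length, so `X 4` and `X 5` may be replaced by `X 1`. This yields
-- 4828/5040, about 0.9579: below 24/25 but still above the target, whence the second pass.
coarse-ratio : ∀ m → 25 * scaled (7 + m) 0 ≤ 24 * scaled (7 + m) 1
coarse-ratio m = *-cancelˡ-≤ 5040 (begin
  5040 * (25 * X 0)     ≡⟨ x∙yz≈y∙xz *-commutativeSemigroup 5040 25 (X 0) ⟩
  25 * (5040 * X 0)     ≤⟨ *-monoʳ-≤ 25 5040x₀≤ ⟩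
  25 * (4828 * X 1)     ≡⟨ sym (*-assoc 25 4828 (X 1)) ⟩
  120700 * X 1          ≤⟨ *-monoˡ-≤ (X 1) (from-yes (120700 ≤? 120960)) ⟩
  120960 * X 1          ≡⟨ *-assoc 5040 24 (X 1) ⟩
  5040 * (24 * X 1)     ∎)
  where
  open ≤-Reasoning
  X = scaled (7 + m)
  1≤4 : X 1 ≤ X 4
  1≤4 = ≤-trans (scaled-mono (5 + m) 1) (≤-trans (scaled-mono (4 + m) 2) (scaled-mono (3 + m) 3))
  5040x₀≤ : 5040 * X 0 ≤ 4828 * X 1
  5040x₀≤ = +-cancelʳ-≤ (212 * X 1) _ _ (begin
    5040 * X 0 + 212 * X 1               ≡⟨ cong (5040 * X 0 +_) (*-distribʳ-+ (X 1) 170 42) ⟩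
    5040 * X 0 + (170 * X 1 + 42 * X 1)  ≤⟨ +-monoʳ-≤ (5040 * X 0) (+-mono-≤ (*-monoʳ-≤ 170 1≤4) (*-monoʳ-≤ 42 (≤-trans 1≤4 (scaled-mono (2 + m) 4)))) ⟩
    5040 * X 0 + (170 * X 4 + 42 * X 5)  ≤⟨ upper m ⟩
    5040 * X 1                           ≡⟨ *-distribʳ-+ (X 1) 4828 212 ⟩
    4828 * X 1 + 212 * X 1               ∎)

-- One substitution of the coarse bound back into the recursion gives the stated constant:
-- (5040 - 170 (25/24)³ - 42 (25/24)⁴) / 5040 = 0.95206…
fine-arith : ∀ x₀ x₁ x₄ x₅ → 5040 * x₀ + (170 * x₄ + 42 * x₅) ≤ 5040 * x₁ →
             15625 * x₁ ≤ 13824 * x₄ → 390625 * x₁ ≤ 331776 * x₅ → 100000 * x₀ ≤ 95586 * x₁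
-- 1672151040 = 5040 · 24⁴ clears the powers of 25/24; 4080 = 170 · 24 since `x₄` needs only 24³.
fine-arith x₀ x₁ x₄ x₅ up x₄≥ x₅≥ = *-cancelˡ-≤ 1672151040 (begin
  1672151040 * (100000 * x₀)     ≡⟨ x∙yz≈y∙xz *-commutativeSemigroup 1672151040 100000 x₀ ⟩
  100000 * (1672151040 * x₀)     ≤⟨ *-monoʳ-≤ 100000 scaled-up ⟩
  100000 * (1591994790 * x₁)     ≡⟨ sym (*-assoc 100000 1591994790 x₁) ⟩
  159199479000000 * x₁           ≤⟨ *-monoˡ-≤ x₁ (from-yes (159199479000000 ≤? 159834229309440)) ⟩
  159834229309440 * x₁           ≡⟨ *-assoc 1672151040 95586 x₁ ⟩
  1672151040 * (95586 * x₁)      ∎)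
  where
  open ≤-Reasoning
  scaled-up : 1672151040 * x₀ ≤ 1591994790 * x₁
  scaled-up = +-cancelʳ-≤ (80156250 * x₁) _ _ (begin
    1672151040 * x₀ + 80156250 * x₁
      ≡⟨ cong₂ _+_ (*-assoc 331776 5040 x₀) (*-distribʳ-+ x₁ 63750000 16406250) ⟩
    331776 * (5040 * x₀) + (63750000 * x₁ + 16406250 * x₁)
      ≡⟨ cong (331776 * (5040 * x₀) +_) (cong₂ _+_ (*-assoc 4080 15625 x₁) (*-assoc 42 390625 x₁)) ⟩
    331776 * (5040 * x₀) + (4080 * (15625 * x₁) + 42 * (390625 * x₁))
      ≤⟨ +-monoʳ-≤ (331776 * (5040 * x₀)) (+-mono-≤ (*-monoʳ-≤ 4080 x₄≥) (*-monoʳ-≤ 42 x₅≥)) ⟩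
    331776 * (5040 * x₀) + (4080 * (13824 * x₄) + 42 * (331776 * x₅))
      ≡⟨ cong (331776 * (5040 * x₀) +_) (cong₂ _+_
           (trans (sym (*-assoc 4080 13824 x₄)) (*-assoc 331776 170 x₄)) (x∙yz≈y∙xz *-commutativeSemigroup 42 331776 x₅)) ⟩
    331776 * (5040 * x₀) + (331776 * (170 * x₄) + 331776 * (42 * x₅))
      ≡⟨ cong (331776 * (5040 * x₀) +_) (sym (*-distribˡ-+ 331776 (170 * x₄) (42 * x₅))) ⟩
    331776 * (5040 * x₀) + 331776 * (170 * x₄ + 42 * x₅)
      ≡⟨ sym (*-distribˡ-+ 331776 (5040 * x₀) (170 * x₄ + 42 * x₅)) ⟩
    331776 * (5040 * x₀ + (170 * x₄ + 42 * x₅))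
      ≤⟨ *-monoʳ-≤ 331776 up ⟩
    331776 * (5040 * x₁)
      ≡⟨ sym (*-assoc 331776 5040 x₁) ⟩
    1672151040 * x₁
      ≡⟨ *-distribʳ-+ x₁ 1591994790 80156250 ⟩
    1591994790 * x₁ + 80156250 * x₁ ∎)

-- The coarse bound starts at length 7 and is used at the four preceding lengths, so this bound
-- starts at length 11.
fine-ratio : ∀ m → 100000 * avoiders (11 + m) ≤ 95586 * (suc (10 + m) * avoiders (10 + m))
fine-ratio m = fine-arith (X 0) (X 1) (X 4) (X 5) (upper (4 + m)) 4≥1
  (ratio-trans 15625 13824 25 24 {X 1} {X 4} {X 5} 4≥1 (scaled-shift 25 24 0 1 (7 + m) 4 (coarse-ratio m)))
  where
  X = scaled (11 + m)
  4≥1 : 15625 * X 1 ≤ 13824 * X 4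
  4≥1 = ratio-trans 25 24 625 576 {X 1} {X 2} {X 4}
    (scaled-shift 25 24 0 1 (10 + m) 1 (coarse-ratio (3 + m)))
    (ratio-trans 25 24 25 24 {X 2} {X 3} {X 4}
      (scaled-shift 25 24 0 1 (9 + m) 2 (coarse-ratio (2 + m)))
      (scaled-shift 25 24 0 1 (8 + m) 3 (coarse-ratio (1 + m))))

avoiders-≤-! : ∀ n → avoiders n ≤ n !
avoiders-≤-! n = subst (avoiders n ≤_) (∑-codes-1 n) (∑-mono (codes n) (λ c → ⟦⟧≤1 (avoids c)))

avoiders-bound : ∀ N → (∀ k → 100000 * avoiders (suc k + N) ≤ 95586 * (suc (k + N) * avoiders (k + N))) →
                 ∀ k → avoiders (k + N) * 100000 ^ k ≤ 95586 ^ k * (k + N) !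
avoiders-bound N step zero    =
  subst₂ _≤_ (sym (*-identityʳ (avoiders N))) (sym (*-identityˡ (N !))) (avoiders-≤-! N)
avoiders-bound N step (suc k) = begin
  avoiders (suc k + N) * (100000 * 100000 ^ k)
    ≡⟨ sym (*-assoc (avoiders (suc k + N)) 100000 (100000 ^ k)) ⟩
  avoiders (suc k + N) * 100000 * 100000 ^ k
    ≡⟨ cong (_* 100000 ^ k) (*-comm (avoiders (suc k + N)) 100000) ⟩
  100000 * avoiders (suc k + N) * 100000 ^ k
    ≤⟨ *-monoˡ-≤ (100000 ^ k) (step k) ⟩
  95586 * (suc (k + N) * avoiders (k + N)) * 100000 ^ k
    ≡⟨ cong (_* 100000 ^ k) (sym (*-assoc 95586 (suc (k + N)) (avoiders (k + N)))) ⟩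
  95586 * suc (k + N) * avoiders (k + N) * 100000 ^ k
    ≡⟨ *-assoc (95586 * suc (k + N)) (avoiders (k + N)) (100000 ^ k) ⟩
  95586 * suc (k + N) * (avoiders (k + N) * 100000 ^ k)
    ≤⟨ *-monoʳ-≤ (95586 * suc (k + N)) (avoiders-bound N step k) ⟩
  95586 * suc (k + N) * (95586 ^ k * (k + N) !)
    ≡⟨ [m*n]*[o*p]≡[m*o]*[n*p] 95586 (suc (k + N)) (95586 ^ k) ((k + N) !) ⟩
  95586 * 95586 ^ k * (suc (k + N) * (k + N) !) ∎
  where open ≤-Reasoning

-- Positions of values and decidability of inversions

place : S n → Fin n → ℕ
place x v = toℕ (x ⟨$⟩ˡ v)

place-injective : ∀ (x : S n) {i j} → place x i ≡ place x j → i ≡ j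
place-injective x eq =
  trans (sym (inverseʳ x)) (trans (cong (x ⟨$⟩ʳ_) (toℕ-injective eq)) (inverseʳ x))

Inv? : ∀ (x : S n) i j → Dec (Inv x i j)
Inv? x i j = (i <?ᶠ j) ×-dec ((x ⟨$⟩ˡ j) <?ᶠ (x ⟨$⟩ˡ i))

≤w-refl : ∀ (x : S n) → x ≤w x
≤w-refl x _ _ = id

≤w-trans : ∀ (x y z : S n) → x ≤w y → y ≤w z → x ≤w z
≤w-trans x y z x≤y y≤z i j = y≤z i j ∘ x≤y i j

-- A cover only denies that something lies strictly between; decidability of inversions turns this
-- into an actual comparison.
≤w-stable : ∀ (x y : S n) → ¬ ¬ (x ≤w y) → x ≤w y
≤w-stable x y ¬¬le i j inv = decidable-stable (Inv? y i j) (λ ¬inv → ¬¬le (λ le → ¬inv (le i j inv)))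

-- Weak-order covers as adjacent transpositions

Desc : S n → Fin n → Fin n → Set
Desc x i j = i <ᶠ j × place x i ≡ suc (place x j)

Desc⇒Inv : ∀ (x : S n) {i j} → Desc x i j → Inv x i j
Desc⇒Inv x (i<j , eq) = i<j , ≤-reflexive (sym eq)

swap : S n → Fin n → Fin n → S n
swap x i j = x ∘ₚ transpose i j

swap-fst : ∀ (x : S n) i j → place (swap x i j) i ≡ place x j
swap-fst x i j = cong (place x) eq
  where
  eq : PC.transpose j i i ≡ j
  eq with i ≟ᶠ j
  ... | yes i≡j = i≡j
  ... | no  _   rewrite dec-true (i ≟ᶠ i) refl = refl

swap-snd : ∀ (x : S n) i j → place (swap x i j) j ≡ place x i
swap-snd x i j = cong (place x) eq
  where
  eq : PC.transpose j i j ≡ i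
  eq rewrite dec-true (j ≟ᶠ j) refl = refl

swap-other : ∀ (x : S n) {i j v} → v ≢ i → v ≢ j → place (swap x i j) v ≡ place x v
swap-other x {i} {j} {v} v≢i v≢j = cong (place x) eq
  where
  eq : PC.transpose j i v ≡ v
  eq rewrite dec-false (v ≟ᶠ j) v≢j | dec-false (v ≟ᶠ i) v≢i = refl

-- An arbitrary covered element is known only through its inversions, so it is described by them
-- instead of as a `swap`. By `below` and `removed`, an element under `x` lies under `c` exactly
-- when it lacks the inversion (i, j); meets are evaluated through this criterion.
record Deletes (x : S n) (i j : Fin n) (c : S n) : Set where
  field
    ⊆-inv   : c ≤w x
    removed : ¬ Inv c i j
    kept    : ∀ {a b} → Inv x a b → ¬ (a ≡ i × b ≡ j) → Inv c a b

  below : ∀ u → u ≤w x → ¬ Inv u i j → u ≤w c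
  below u u≤x ¬inv a b inv = kept (u≤x a b inv) λ { (refl , refl) → ¬inv inv }

open Deletes

swap-deletes : ∀ (x : S n) {i j} → Desc x i j → Deletes x i j (swap x i j)
swap-deletes x {i} {j} (i<j , adj) = record
  { ⊆-inv = sub ; removed = λ (_ , lt) → <⇒≯ (subst₂ _<_ (swap-snd x i j) (swap-fst x i j) lt) (≤-reflexive (sym adj)) ; kept = keep }
  where
  P = place x
  P′ = place (swap x i j)
  locate : ∀ v → v ≡ i ⊎ v ≡ j ⊎ (v ≢ i × v ≢ j)
  locate v with v ≟ᶠ i | v ≟ᶠ j
  ... | yes eq | _      = inj₁ eq
  ... | no _   | yes eq = inj₂ (inj₁ eq)
  ... | no v≢i | no v≢j = inj₂ (inj₂ (v≢i , v≢j))
  same : ∀ {v} → v ≢ i × v ≢ j → P′ v ≡ P v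
  same (v≢i , v≢j) = swap-other x v≢i v≢j
  P′i : P′ i ≡ P j
  P′i = swap-fst x i j
  P′j : P′ j ≡ suc (P j)
  P′j = trans (swap-snd x i j) adj
  P≢ : ∀ {v} → v ≢ i × v ≢ j → suc (P j) ≢ P v
  P≢ (v≢i , _) eq = v≢i (place-injective x (trans (sym eq) (sym adj)))
  sub : swap x i j ≤w x
  sub a b (a<b , lt) = a<b , go (locate a) (locate b)
    where
    go : a ≡ i ⊎ a ≡ j ⊎ (a ≢ i × a ≢ j) → b ≡ i ⊎ b ≡ j ⊎ (b ≢ i × b ≢ j) → P b < P a
    go (inj₁ refl)        (inj₁ refl)        = contradiction a<b (<-irrefl refl)
    go (inj₁ refl)        (inj₂ (inj₁ refl)) = ≤-reflexive (sym adj)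
    go (inj₁ refl)        (inj₂ (inj₂ b≢))   = subst (P b <_) (sym adj) (m<n⇒m<1+n (subst₂ _<_ (same b≢) P′i lt))
    go (inj₂ (inj₁ refl)) (inj₁ refl)        = contradiction a<b (<⇒≯ i<j)
    go (inj₂ (inj₁ refl)) (inj₂ (inj₁ refl)) = contradiction a<b (<-irrefl refl)
    go (inj₂ (inj₁ refl)) (inj₂ (inj₂ b≢))   =
      ≤∧≢⇒< (≤-pred (subst₂ _<_ (same b≢) P′j lt)) (proj₂ b≢ ∘ place-injective x)
    go (inj₂ (inj₂ a≢))   (inj₁ refl)        =
      subst (_< P a) (sym adj) (≤∧≢⇒< (subst₂ _<_ P′i (same a≢) lt) (P≢ a≢))
    go (inj₂ (inj₂ a≢))   (inj₂ (inj₁ refl)) = <-trans (n<1+n (P j)) (subst₂ _<_ P′j (same a≢) lt)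
    go (inj₂ (inj₂ a≢))   (inj₂ (inj₂ b≢))   = subst₂ _<_ (same b≢) (same a≢) lt
  keep : ∀ {a b} → Inv x a b → ¬ (a ≡ i × b ≡ j) → Inv (swap x i j) a b
  keep {a} {b} (a<b , lt) neq = a<b , go (locate a) (locate b)
    where
    go : a ≡ i ⊎ a ≡ j ⊎ (a ≢ i × a ≢ j) → b ≡ i ⊎ b ≡ j ⊎ (b ≢ i × b ≢ j) → P′ b < P′ a
    go (inj₁ refl)        (inj₁ refl)        = contradiction a<b (<-irrefl refl)
    go (inj₁ refl)        (inj₂ (inj₁ refl)) = contradiction (refl , refl) neq
    go (inj₁ refl)        (inj₂ (inj₂ b≢))   = subst₂ _<_ (sym (same b≢)) (sym P′i)
      (≤∧≢⇒< (≤-pred (subst (P b <_) adj lt)) (proj₂ b≢ ∘ place-injective x))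
    go (inj₂ (inj₁ refl)) (inj₁ refl)        = contradiction a<b (<⇒≯ i<j)
    go (inj₂ (inj₁ refl)) (inj₂ (inj₁ refl)) = contradiction a<b (<-irrefl refl)
    go (inj₂ (inj₁ refl)) (inj₂ (inj₂ b≢))   = subst₂ _<_ (sym (same b≢)) (sym P′j) (m<n⇒m<1+n lt)
    go (inj₂ (inj₂ a≢))   (inj₁ refl)        = subst₂ _<_ (sym P′i) (sym (same a≢))
      (<-trans (n<1+n (P j)) (subst (_< P a) adj lt))
    go (inj₂ (inj₂ a≢))   (inj₂ (inj₁ refl)) = subst₂ _<_ (sym P′j) (sym (same a≢)) (≤∧≢⇒< lt (P≢ a≢))
    go (inj₂ (inj₂ a≢))   (inj₂ (inj₂ b≢))   = subst₂ _<_ (sym (same b≢)) (sym (same a≢)) lt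

swap-< : ∀ (x : S n) {i j} → Desc x i j → swap x i j <w x
swap-< x {i} {j} desc = ⊆-inv del , λ x≤c → removed del (x≤c i j (Desc⇒Inv x desc))
  where del = swap-deletes x desc

swap-covers : ∀ (x : S n) {i j} → Desc x i j → Covers x (swap x i j)
swap-covers x {i} {j} desc = swap-< x desc , between
  where
  del = swap-deletes x desc
  between : ∀ z → swap x i j <w z → ¬ (z <w x)
  between z (c≤z , z≰c) (z≤x , x≰z) with Inv? z i j
  ... | no ¬inv = z≰c (below del z z≤x ¬inv)
  ... | yes inv = x≰z all-in
    where
    all-in : x ≤w z
    all-in a b x-inv with (a ≟ᶠ i) ×-dec (b ≟ᶠ j)
    ... | yes (refl , refl) = inv
    ... | no neq = c≤z a b (kept del x-inv neq)

¬Inv⇒before : ∀ (x : S n) {i j} → i <ᶠ j → ¬ Inv x i j → place x i < place x j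
¬Inv⇒before x {i} {j} i<j ¬inv with <-cmp (place x i) (place x j)
... | tri< lt _ _ = lt
... | tri≈ _ eq _ = contradiction i<j (<-irrefl (cong toℕ (place-injective x eq)))
... | tri> _ _ gt = contradiction (i<j , gt) ¬inv

module _ (y c : S n) (c≤y : c ≤w y) (descs : ∀ i j → Desc y i j → Inv c i j) where

  -- With m the value right after j in y, c places j before m and m before i.
  Inv-by-distance : ∀ d i j → i <ᶠ j → place y i ≡ suc d + place y j → place c j < place c i
  Inv-by-distance zero    i j i<j eq = proj₂ (descs i j (i<j , eq))
  Inv-by-distance (suc d) i j i<j eq = <-trans j-before-m m-before-i
    where
    next<n : suc (place y j) < n
    next<n = ≤-trans (s≤s (s≤s (m≤n+m (place y j) d))) (≤-trans (≤-reflexive (sym eq)) (<⇒≤ (toℕ<n _)))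
    m : Fin n
    m = y ⟨$⟩ʳ fromℕ< next<n
    place-m : place y m ≡ suc (place y j)
    place-m = trans (cong toℕ (inverseˡ y)) (toℕ-fromℕ< next<n)
    i-after-m : place y i ≡ suc d + place y m
    i-after-m = trans eq (trans (cong suc (sym (+-suc d _))) (cong (suc d +_) (sym place-m)))
    j-before-m : place c j < place c m
    j-before-m with <-cmp (toℕ m) (toℕ j)
    ... | tri< m<j _ _ = proj₂ (descs m j (m<j , place-m))
    ... | tri≈ _ m≡j _ = contradiction (trans (cong (place y) (sym (toℕ-injective m≡j))) place-m) (<⇒≢ (n<1+n _))
    ... | tri> _ _ j<m = ¬Inv⇒before c j<m λ inv →
      <⇒≯ (proj₂ (c≤y j m inv)) (≤-reflexive (sym place-m))
    m-before-i : place c m < place c i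
    m-before-i with <-cmp (toℕ m) (toℕ i)
    ... | tri> _ _ i<m = Inv-by-distance d i m i<m i-after-m
    ... | tri≈ _ m≡i _ = contradiction (trans (cong (place y) (toℕ-injective m≡i)) i-after-m) (<⇒≢ (s≤s (m≤n+m _ d)))
    ... | tri< m<i _ _ = ¬Inv⇒before c m<i λ inv →
      <⇒≯ (proj₂ (c≤y m i inv)) (≤-trans (s≤s (m≤n+m _ d)) (≤-reflexive (sym i-after-m)))

  descs⇒≥ : y ≤w c
  descs⇒≥ i j (i<j , lt) = i<j , Inv-by-distance (place y i ∸ suc (place y j)) i j i<j
    (trans (sym (m∸n+n≡m lt)) (+-suc _ _))

-- If `c` kept every descent of `y` it would lie above `y`. At a missing descent the swap lies
-- between `c` and `y`, hence has the same inversions as `c`.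
covers⇒Desc : ∀ (y c : S n) → Covers y c → ∃₂ λ i j → Desc y i j × Deletes y i j c
covers⇒Desc {n} y c ((c≤y , y≰c) , between) with any? (λ i → any? (λ j → missing? i j))
  where
  missing? : ∀ i j → Dec (Desc y i j × ¬ Inv c i j)
  missing? i j = ((i <?ᶠ j) ×-dec (place y i ≟ suc (place y j))) ×-dec ¬? (Inv? c i j)
... | no none = contradiction (descs⇒≥ y c c≤y λ i j desc →
        decidable-stable (Inv? c i j) (λ ¬inv → none (i , j , desc , ¬inv))) y≰c
... | yes (i , j , desc , ¬inv) = i , j , desc , record
  { ⊆-inv = c≤y ; removed = ¬inv ; kept = λ {a} {b} inv neq → s≤c a b (kept del inv neq) }
  where
  del = swap-deletes y desc
  s≤c : swap y i j ≤w c
  s≤c = ≤w-stable (swap y i j) c λ s≰c → between (swap y i j) (below del c c≤y ¬inv , s≰c) (swap-< y desc)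

-- Inversion numbers and fuel

∑-strict : ∀ {A : Set} (xs : List A) {f g : A → ℕ} → (∀ x → f x ≤ g x) →
           ∀ {x} → x ∈ xs → f x < g x → ∑ xs f < ∑ xs g
∑-strict (x ∷ xs) le (here refl) lt = +-mono-<-≤ lt (∑-mono xs le)
∑-strict (y ∷ xs) le (there x∈)  lt = +-mono-≤-< (le y) (∑-strict xs le x∈ lt)

∑-≤-length : ∀ {A : Set} (xs : List A) {f : A → ℕ} b → (∀ x → f x ≤ b) → ∑ xs f ≤ length xs * b
∑-≤-length []       b le = z≤n
∑-≤-length (x ∷ xs) b le = +-mono-≤ (le x) (∑-≤-length xs b le)

inv-at : S n → Fin n → Fin n → ℕ
inv-at x i j = ⟦ does (Inv? x i j) ⟧

inversions : S n → ℕ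
inversions {n} x = ∑ (allFin n) (λ i → ∑ (allFin n) (inv-at x i))

⟦does⟧-mono : ∀ {A B : Set} (a? : Dec A) (b? : Dec B) → (A → B) → ⟦ does a? ⟧ ≤ ⟦ does b? ⟧
⟦does⟧-mono (no _)  _       f = z≤n
⟦does⟧-mono (yes _) (yes _) f = ≤-refl
⟦does⟧-mono (yes a) (no ¬b) f = contradiction (f a) ¬b

⟦does⟧-strict : ∀ {A B : Set} (a? : Dec A) (b? : Dec B) → ¬ A → B → ⟦ does a? ⟧ < ⟦ does b? ⟧
⟦does⟧-strict (yes a) _       ¬a b = contradiction a ¬a
⟦does⟧-strict (no _)  (yes _) ¬a b = ≤-refl
⟦does⟧-strict (no _)  (no ¬b) ¬a b = contradiction b ¬b

inv-at-mono : ∀ (x y : S n) → x ≤w y → ∀ i j → inv-at x i j ≤ inv-at y i j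
inv-at-mono x y x≤y i j = ⟦does⟧-mono (Inv? x i j) (Inv? y i j) (x≤y i j)

inversions-≤ : ∀ (x : S n) → inversions x ≤ n * n
inversions-≤ {n} x = subst (inversions x ≤_) (cong₂ _*_ len (trans (*-identityʳ _) len))
  (∑-≤-length (allFin n) _ (λ i → ∑-≤-length (allFin n) 1 (λ j → ⟦⟧≤1 (does (Inv? x i j)))))
  where
  len : length (allFin n) ≡ n
  len = length-tabulate id

inversions-strict : ∀ (x y : S n) → x <w y → inversions x < inversions y
inversions-strict {n} x y (x≤y , y≰x) with any? (λ i → any? (λ j → Inv? y i j ×-dec ¬? (Inv? x i j)))
... | no none = contradiction (λ i j inv → decidable-stable (Inv? x i j) (λ ¬inv → none (i , j , inv , ¬inv))) y≰x
... | yes (i , j , inv , ¬inv) =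
  ∑-strict (allFin n) (λ i → ∑-mono (allFin n) (inv-at-mono x y x≤y i)) (∈-allFin i)
    (∑-strict (allFin n) (inv-at-mono x y x≤y i) (∈-allFin j) (⟦does⟧-strict (Inv? x i j) (Inv? y i j) ¬inv inv))

move-< : ∀ (x y : S n) → UngarMove x y → y <w x
move-< x y ([]    , T≢[] , _)                                            = contradiction refl T≢[]
move-< x y (c ∷ T , _    , ((_ , x≰c) , _) ∷ _ , (y≤x , y≤c ∷ _) , _) = y≤x , λ x≤y → x≰c (λ i j → y≤c i j ∘ x≤y i j)

move-inversions : ∀ (x y : S n) → UngarMove x y → inversions y < inversions x
move-inversions x y = inversions-strict y x ∘ move-< x y

-- Every move loses an inversion, so play from `z` ends before `k` units of fuel run out and one
-- more unit changes nothing.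
fuel-stable : ∀ k (z : S n) → inversions z ≤ k →
              (EetaWinFuel k z → EetaWinFuel (suc k) z) × (EetaWinFuel (suc k) z → EetaWinFuel k z)
fuel-stable zero    z le = (λ _ y mv _ → n≮0 (<-≤-trans (move-inversions z y mv) le)) , λ _ → tt
fuel-stable (suc k) z le =
  (λ win y mv → win y mv ∘ proj₂ (fuel-stable k y (inv≤k y mv))) ,
  (λ win y mv → win y mv ∘ proj₁ (fuel-stable k y (inv≤k y mv)))
  where
  inv≤k : ∀ y → UngarMove z y → inversions y ≤ k
  inv≤k y mv = ≤-pred (≤-trans (move-inversions z y mv) le)

-- Strategy stealing: whichever of y and its options is an Eeta win, Atniss can move there from x.
dominated⇒¬Eeta : ∀ (x y : S n) → UngarMove x y → (∀ z → UngarMove y z → UngarMove x z) → ¬ EetaWin x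
dominated⇒¬Eeta {n} x y mv options = go (n * n) (inversions-≤ x)
  where
  go : ∀ k → inversions x ≤ k → ¬ EetaWinFuel k x
  go zero          le win = n≮0 (<-≤-trans (move-inversions x y mv) le)
  go (suc zero)    le win = win y mv tt
  -- Reached directly from `x`, the position `z` has one unit of fuel more than when reached through
  -- `y`; its at most `k` inversions make the two verdicts agree.
  go (suc (suc k)) le win = win y mv λ z mv′ winz →
    win z (options z mv′) (proj₁ (fuel-stable k z
      (≤-pred (≤-trans (move-inversions y z mv′) (≤-pred (≤-trans (move-inversions x y mv) le))))) winz)

-- Each cover of `y` removes a descent that `x` shares, and is replaced by the cover of `x` at that
-- descent. For `u ≤w y`, lying under either one means lacking the same inversion.
lift-covers : ∀ (x y : S n) → y ≤w x → (∀ i j → Desc y i j → Desc x i j) →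
  ∀ T → All (Covers y) T → Σ (List (S n)) λ T′ → All (Covers x) T′ ×
    (∀ u → u ≤w y → All (u ≤w_) T → All (u ≤w_) T′) × (∀ u → u ≤w y → All (u ≤w_) T′ → All (u ≤w_) T)
lift-covers x y y≤x descs []      []         = [] , [] , (λ _ _ _ → []) , (λ _ _ _ → [])
lift-covers x y y≤x descs (c ∷ T) (cov ∷ covs) =
  let i , j , desc , del    = covers⇒Desc y c cov
      T′ , covs′ , to , from = lift-covers x y y≤x descs T covs
      desc′ = descs i j desc
      del′  = swap-deletes x desc′
  in swap x i j ∷ T′ , swap-covers x desc′ ∷ covs′ ,
     (λ { u u≤y (u≤c ∷ us) → below del′ u (≤w-trans u y x u≤y y≤x) (removed del ∘ u≤c i j) ∷ to u u≤y us }) ,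
     (λ { u u≤y (u≤c ∷ us) → below del u u≤y (removed del′ ∘ u≤c i j) ∷ from u u≤y us })

-- Both moves are made at once with `T₀ ++ T′`: the part `T₀` forces a lower bound below `y`, and
-- there `T′` cuts out the same elements as `T`.
absorb : ∀ (x y : S n) → UngarMove x y → (∀ i j → Desc y i j → Desc x i j) →
         ∀ z → UngarMove y z → UngarMove x z
absorb x y (T₀ , T₀≢[] , covs₀ , (y≤x , y≤T₀) , greatest₀) descs z (T , _ , covs , (z≤y , z≤T) , greatest) =
  let T′ , covs′ , to , from = lift-covers x y y≤x descs T covs
  in T₀ ++ T′ , ++≢[] T₀≢[] , All.++⁺ covs₀ covs′ ,
     (≤w-trans z y x z≤y y≤x ,
      All.++⁺ (All.map (λ {t} y≤t → ≤w-trans z y t z≤y y≤t) y≤T₀) (to z z≤y z≤T)) ,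
     λ u u≤x u≤all → let u≤y = greatest₀ u u≤x (All.++⁻ˡ T₀ u≤all)
                     in greatest u u≤y (from u u≤y (All.++⁻ʳ T₀ u≤all))
  where
  ++≢[] : ∀ {A : Set} {xs ys : List A} → xs ≢ [] → xs ++ ys ≢ []
  ++≢[] {xs = []}    xs≢[] _ = xs≢[] refl
  ++≢[] {xs = _ ∷ _} _     ()

-- Both neighbours of v in y form ascents with it, so no descent of y involves v.
Isolated : S n → Fin n → Set
Isolated y v = (∃ λ r → r <ᶠ v × place y v ≡ suc (place y r)) × (∃ λ s → v <ᶠ s × place y s ≡ suc (place y v))

Desc-transfer : ∀ (x y : S n) → (∀ v → place y v ≡ place x v ⊎ Isolated y v) →
                ∀ i j → Desc y i j → Desc x i j
Desc-transfer x y agree i j (i<j , adj) with agree i | agree j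
... | inj₁ eqi | inj₁ eqj = i<j , trans (sym eqi) (trans adj (cong suc eqj))
... | inj₂ ((r , r<i , eq) , _) | _ =
  contradiction (subst (i <ᶠ_) (place-injective y (suc-injective (trans (sym adj) eq))) i<j) (<⇒≯ r<i)
... | inj₁ _ | inj₂ (_ , s , j<s , eq) =
  contradiction (subst (_<ᶠ j) (place-injective y (trans adj (sym eq))) i<j) (<⇒≯ j<s)

suc-resp : ∀ {p p′ q q′} → p ≡ p′ → q ≡ q′ → q′ ≡ suc p′ → q ≡ suc p
suc-resp refl refl eq = eq

-- Strategy stealing for the two patterns

1324⇒¬Eeta : ∀ (x : S n) v₀ v₁ v₂ v₃ →
  place x v₁ ≡ suc (place x v₀) → place x v₂ ≡ suc (place x v₁) → place x v₃ ≡ suc (place x v₂) →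
  v₀ <ᶠ v₂ → v₂ <ᶠ v₁ → v₁ <ᶠ v₃ → ¬ EetaWin x
1324⇒¬Eeta {n} x v₀ v₁ v₂ v₃ at₁ at₂ at₃ v₀<v₂ v₂<v₁ v₁<v₃ =
  dominated⇒¬Eeta x y move (absorb x y move (Desc-transfer x y agree))
  where
  desc : Desc x v₂ v₁
  desc = v₂<v₁ , at₂
  y : S n
  y = swap x v₂ v₁
  move : UngarMove x y
  move = y ∷ [] , (λ ()) , swap-covers x desc ∷ [] ,
    (⊆-inv (swap-deletes x desc) , ≤w-refl y ∷ []) , λ { _ _ (u≤y ∷ []) → u≤y }
  y₀ : place y v₀ ≡ place x v₀
  y₀ = swap-other x (<ᶠ⇒≢ v₀<v₂) (<ᶠ⇒≢ (<-trans v₀<v₂ v₂<v₁))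
  y₁ : place y v₁ ≡ place x v₂
  y₁ = swap-snd x v₂ v₁
  y₂ : place y v₂ ≡ place x v₁
  y₂ = swap-fst x v₂ v₁
  y₃ : place y v₃ ≡ place x v₃
  y₃ = swap-other x (≢-sym (<ᶠ⇒≢ (<-trans v₂<v₁ v₁<v₃))) (≢-sym (<ᶠ⇒≢ v₁<v₃))
  agree : ∀ v → place y v ≡ place x v ⊎ Isolated y v
  agree v = cases (v ≟ᶠ v₁) (v ≟ᶠ v₂)
    where
    cases : Dec (v ≡ v₁) → Dec (v ≡ v₂) → place y v ≡ place x v ⊎ Isolated y v
    cases (yes refl) _          = inj₂ ((v₂ , v₂<v₁ , suc-resp y₂ y₁ at₂) , (v₃ , v₁<v₃ , suc-resp y₁ y₃ at₃))
    cases (no _)     (yes refl) = inj₂ ((v₀ , v₀<v₂ , suc-resp y₀ y₂ at₁) , (v₁ , v₂<v₁ , suc-resp y₂ y₁ at₂))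
    cases (no ≢₁)    (no ≢₂)    = inj₁ (swap-other x ≢₂ ≢₁)

14325⇒¬Eeta : ∀ (x : S n) v₀ v₁ v₂ v₃ v₄ →
  place x v₁ ≡ suc (place x v₀) → place x v₂ ≡ suc (place x v₁) → place x v₃ ≡ suc (place x v₂) →
  place x v₄ ≡ suc (place x v₃) → v₀ <ᶠ v₃ → v₃ <ᶠ v₂ → v₂ <ᶠ v₁ → v₁ <ᶠ v₄ → ¬ EetaWin x
14325⇒¬Eeta {n} x v₀ v₁ v₂ v₃ v₄ at₁ at₂ at₃ at₄ v₀<v₃ v₃<v₂ v₂<v₁ v₁<v₄ =
  dominated⇒¬Eeta x y move (absorb x y move (Desc-transfer x y agree))
  where
  v₃<v₁ : v₃ <ᶠ v₁
  v₃<v₁ = <-trans v₃<v₂ v₂<v₁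
  -- On the block 432 these are `c` = 342, `z` = 324, `y` = 234 and `d` = 423. The covers `c` and
  -- `d` form the move, and their meet is `y`; `z` is only a stage on the way from `c` to `y`.
  c d z y : S n
  c = swap x v₂ v₁
  d = swap x v₃ v₂
  z = swap c v₃ v₁
  y = swap z v₃ v₂
  descc : Desc x v₂ v₁
  descc = v₂<v₁ , at₂
  descd : Desc x v₃ v₂
  descd = v₃<v₂ , at₃
  c₁ : place c v₁ ≡ place x v₂
  c₁ = swap-snd x v₂ v₁
  c₂ : place c v₂ ≡ place x v₁
  c₂ = swap-fst x v₂ v₁
  c₃ : place c v₃ ≡ place x v₃
  c₃ = swap-other x (<ᶠ⇒≢ v₃<v₂) (<ᶠ⇒≢ v₃<v₁)
  descz : Desc c v₃ v₁
  descz = v₃<v₁ , trans c₃ (trans at₃ (cong suc (sym c₁)))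
  z₁ : place z v₁ ≡ place x v₃
  z₁ = trans (swap-snd c v₃ v₁) c₃
  z₂ : place z v₂ ≡ place x v₁
  z₂ = trans (swap-other c (≢-sym (<ᶠ⇒≢ v₃<v₂)) (<ᶠ⇒≢ v₂<v₁)) c₂
  z₃ : place z v₃ ≡ place x v₂
  z₃ = trans (swap-fst c v₃ v₁) c₁
  descy : Desc z v₃ v₂
  descy = v₃<v₂ , trans z₃ (trans at₂ (cong suc (sym z₂)))
  delc = swap-deletes x descc
  deld = swap-deletes x descd
  delz = swap-deletes c descz
  dely = swap-deletes z descy
  y₁ : place y v₁ ≡ place x v₃
  y₁ = trans (swap-other z (≢-sym (<ᶠ⇒≢ v₃<v₁)) (≢-sym (<ᶠ⇒≢ v₂<v₁))) z₁
  y₂ : place y v₂ ≡ place x v₂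
  y₂ = trans (swap-snd z v₃ v₂) z₃
  y₃ : place y v₃ ≡ place x v₁
  y₃ = trans (swap-fst z v₃ v₂) z₂
  y-other : ∀ {v} → v ≢ v₁ → v ≢ v₂ → v ≢ v₃ → place y v ≡ place x v
  y-other ≢₁ ≢₂ ≢₃ = trans (swap-other z ≢₃ ≢₂) (trans (swap-other c ≢₃ ≢₁) (swap-other x ≢₂ ≢₁))
  y₀ : place y v₀ ≡ place x v₀
  y₀ = y-other (<ᶠ⇒≢ (<-trans v₀<v₃ v₃<v₁)) (<ᶠ⇒≢ (<-trans v₀<v₃ v₃<v₂)) (<ᶠ⇒≢ v₀<v₃)
  y₄ : place y v₄ ≡ place x v₄
  y₄ = y-other (≢-sym (<ᶠ⇒≢ v₁<v₄)) (≢-sym (<ᶠ⇒≢ (<-trans v₂<v₁ v₁<v₄))) (≢-sym (<ᶠ⇒≢ (<-trans v₃<v₁ v₁<v₄)))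
  y≤c : y ≤w c
  y≤c = ≤w-trans y z c (⊆-inv dely) (⊆-inv delz)
  y≤x : y ≤w x
  y≤x = ≤w-trans y c x y≤c (⊆-inv delc)
  greatest : ∀ u → u ≤w x → All (u ≤w_) (c ∷ d ∷ []) → u ≤w y
  greatest u u≤x (u≤c ∷ u≤d ∷ []) = below dely u (below delz u u≤c ¬v₃v₁) ¬v₃v₂
    where
    ¬v₃v₂ : ¬ Inv u v₃ v₂
    ¬v₃v₂ = removed deld ∘ u≤d v₃ v₂
    -- Lacking both adjacent inversions, `u` places `v₃` before `v₂` and `v₂` before `v₁`, so the
    -- third inversion of the block is missing too.
    ¬v₃v₁ : ¬ Inv u v₃ v₁
    ¬v₃v₁ (_ , lt) = <⇒≯ lt (<-trans (¬Inv⇒before u v₃<v₂ ¬v₃v₂)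
                                     (¬Inv⇒before u v₂<v₁ (removed delc ∘ u≤c v₂ v₁)))
  move : UngarMove x y
  move = c ∷ d ∷ [] , (λ ()) , swap-covers x descc ∷ swap-covers x descd ∷ [] ,
    (y≤x , y≤c ∷ below deld y y≤x (removed dely) ∷ []) , greatest
  agree : ∀ v → place y v ≡ place x v ⊎ Isolated y v
  agree v = cases (v ≟ᶠ v₁) (v ≟ᶠ v₂) (v ≟ᶠ v₃)
    where
    cases : Dec (v ≡ v₁) → Dec (v ≡ v₂) → Dec (v ≡ v₃) → place y v ≡ place x v ⊎ Isolated y v
    cases (yes refl) _          _          = inj₂ ((v₂ , v₂<v₁ , suc-resp y₂ y₁ at₃) , (v₄ , v₁<v₄ , suc-resp y₁ y₄ at₄))
    -- Reversing a block of three leaves its middle entry in place.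
    cases (no _)     (yes refl) _          = inj₁ y₂
    cases (no _)     (no _)     (yes refl) = inj₂ ((v₀ , v₀<v₃ , suc-resp y₀ y₃ at₁) , (v₂ , v₃<v₂ , suc-resp y₃ y₂ at₂))
    cases (no ≢₁)    (no ≢₂)    (no ≢₃)    = inj₁ (y-other ≢₁ ≢₂ ≢₃)

-- Codes of permutations

rankBelow : (ℕ → ℕ) → ℕ → ℕ → ℕ
rankBelow V zero    v = 0
rankBelow V (suc t) v = ⟦ does (V t <? v) ⟧ + rankBelow V t v

code : (ℕ → ℕ) → (t : ℕ) → Vec ℕ t
code V zero    = []
code V (suc t) = rankBelow V t (V t) ∷ code V t

module _ (V : ℕ → ℕ) where

  rankBelow-≤ : ∀ t v → rankBelow V t v ≤ t
  rankBelow-≤ zero    v = z≤n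
  rankBelow-≤ (suc t) v = +-mono-≤ (⟦⟧≤1 _) (rankBelow-≤ t v)

  rankBelow-mono : ∀ t {u v} → u ≤ v → rankBelow V t u ≤ rankBelow V t v
  rankBelow-mono zero            u≤v = z≤n
  rankBelow-mono (suc t) {u} {v} u≤v = +-mono-≤
    (⟦does⟧-mono (V t <? u) (V t <? v) (λ lt → <-≤-trans lt u≤v)) (rankBelow-mono t u≤v)

  rankBelow-step : ∀ t v → rankBelow V (suc t) v ≤ suc (rankBelow V t v)
  rankBelow-step t v = +-monoˡ-≤ _ (⟦⟧≤1 _)

  rankBelow-yes : ∀ t {v} → V t < v → rankBelow V (suc t) v ≡ suc (rankBelow V t v)
  rankBelow-yes t {v} lt = cong (λ b → ⟦ b ⟧ + rankBelow V t v) (dec-true (V t <? v) lt)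

  rankBelow-no : ∀ t {v} → v ≤ V t → rankBelow V (suc t) v ≡ rankBelow V t v
  rankBelow-no t {v} le = cong (λ b → ⟦ b ⟧ + rankBelow V t v) (dec-false (V t <? v) (≤⇒≯ le))

  rankBelow-strict : ∀ t {p v} → p < t → V p < v → rankBelow V t (V p) < rankBelow V t v
  rankBelow-strict (suc t) {p} {v} (s≤s p≤t) lt with m≤n⇒m<n∨m≡n p≤t
  ... | inj₁ p<t  = +-mono-≤-< (⟦does⟧-mono (V t <? V p) (V t <? v) (λ lt′ → <-trans lt′ lt)) (rankBelow-strict t p<t lt)
  ... | inj₂ refl = subst₂ _<_ (sym (rankBelow-no t ≤-refl)) (sym (rankBelow-yes t lt)) (s≤s (rankBelow-mono t (<⇒≤ lt)))

  private
    r : ℕ → ℕ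
    r t = rankBelow V t (V t)

  code-descent : ∀ t → r (1 + t) ≤ r t → V (1 + t) ≤ V t
  code-descent t le = ≮⇒≥ λ lt → <⇒≱ (s≤s (rankBelow-mono t (<⇒≤ lt))) (subst (_≤ r t) (rankBelow-yes t lt) le)

  -- Each strict inequality holds by contraposition, since a reversed comparison of values would
  -- bound the code entry from above. The middle one is weak because `V` may repeat values here;
  -- injectivity makes it strict later.
  code-1324 : ∀ t → is1324 (r (3 + t)) (r (2 + t)) (r (1 + t)) (r t) ≡ true →
              V t < V (2 + t) × V (2 + t) ≤ V (1 + t) × V (1 + t) < V (3 + t)
  code-1324 t eq =
    let a<c , c≤b , sb<d = is1324⁻ {r (3 + t)} {r (2 + t)} {r (1 + t)} {r t} eq
        v₂≤v₁ = code-descent (1 + t) c≤b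
    in (≰⇒> λ v₂≤v₀ → <⇒≱ a<c (begin
          rankBelow V (2 + t) (V (2 + t)) ≡⟨ rankBelow-no (1 + t) v₂≤v₁ ⟩
          rankBelow V (1 + t) (V (2 + t)) ≡⟨ rankBelow-no t v₂≤v₀ ⟩
          rankBelow V t (V (2 + t))       ≤⟨ rankBelow-mono t v₂≤v₀ ⟩
          r t                             ∎)) ,
       v₂≤v₁ ,
       (≰⇒> λ v₃≤v₁ → <⇒≱ sb<d (begin
          rankBelow V (3 + t) (V (3 + t))       ≤⟨ rankBelow-mono (3 + t) v₃≤v₁ ⟩
          rankBelow V (3 + t) (V (1 + t))       ≤⟨ rankBelow-step (2 + t) (V (1 + t)) ⟩
          suc (rankBelow V (2 + t) (V (1 + t))) ≡⟨ cong suc (rankBelow-no (1 + t) ≤-refl) ⟩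
          suc (r (1 + t))                       ∎))
    where open ≤-Reasoning

  code-14325 : ∀ t → is14325 (r (4 + t)) (r (3 + t)) (r (2 + t)) (r (1 + t)) (r t) ≡ true →
               V t < V (3 + t) × V (3 + t) ≤ V (2 + t) × V (2 + t) ≤ V (1 + t) × V (1 + t) < V (4 + t)
  code-14325 t eq =
    let a<d , c≤b , d≤c , ssb<e = is14325⁻ {r (4 + t)} {r (3 + t)} {r (2 + t)} {r (1 + t)} {r t} eq
        v₂≤v₁ = code-descent (1 + t) c≤b
        v₃≤v₂ = code-descent (2 + t) d≤c
    in (≰⇒> λ v₃≤v₀ → <⇒≱ a<d (begin
          rankBelow V (3 + t) (V (3 + t)) ≡⟨ rankBelow-no (2 + t) v₃≤v₂ ⟩
          rankBelow V (2 + t) (V (3 + t)) ≡⟨ rankBelow-no (1 + t) (≤-trans v₃≤v₂ v₂≤v₁) ⟩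
          rankBelow V (1 + t) (V (3 + t)) ≡⟨ rankBelow-no t v₃≤v₀ ⟩
          rankBelow V t (V (3 + t))       ≤⟨ rankBelow-mono t v₃≤v₀ ⟩
          r t                             ∎)) ,
       v₃≤v₂ , v₂≤v₁ ,
       (≰⇒> λ v₄≤v₁ → <⇒≱ ssb<e (begin
          rankBelow V (4 + t) (V (4 + t))             ≤⟨ rankBelow-mono (4 + t) v₄≤v₁ ⟩
          rankBelow V (4 + t) (V (1 + t))             ≤⟨ rankBelow-step (3 + t) (V (1 + t)) ⟩
          suc (rankBelow V (3 + t) (V (1 + t)))       ≤⟨ s≤s (rankBelow-step (2 + t) (V (1 + t))) ⟩
          suc (suc (rankBelow V (2 + t) (V (1 + t)))) ≡⟨ cong (suc ∘ suc) (rankBelow-no (1 + t) ≤-refl) ⟩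
          suc (suc (r (1 + t)))                       ∎))
    where open ≤-Reasoning

  code∈codes : ∀ t → code V t ∈ codes t
  code∈codes zero    = here refl
  code∈codes (suc t) = ∈-concatMap⁺ (λ c → map (_∷ c) (upTo (suc t)))
    (Any.map (λ { refl → ∈-map⁺ (_∷ code V t) (∈-upTo⁺ (s≤s (rankBelow-≤ t (V t)))) }) (code∈codes t))

InjectiveBelow : ℕ → (ℕ → ℕ) → Set
InjectiveBelow n V = ∀ {p q} → p < n → q < n → V p ≡ V q → p ≡ q

OrderPreserving : ℕ → (ℕ → ℕ) → (ℕ → ℕ) → Set
OrderPreserving t U V = ∀ {p q} → p < t → q < t → U p < U q → V p < V q

rankBelow-cong : ∀ t {U V u v} → (∀ {q} → q < t → U q < u → V q < v) → rankBelow U t u ≤ rankBelow V t v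
rankBelow-cong zero                    imp = z≤n
rankBelow-cong (suc t) {U} {V} {u} {v} imp =
  +-mono-≤ (⟦does⟧-mono (U t <? u) (V t <? v) (imp ≤-refl)) (rankBelow-cong t (λ q<t → imp (m<n⇒m<1+n q<t)))

-- The rank of the new entry is compared with that of an earlier one, transported between `U` and
-- `V`. The transport runs from `V` to `U` if the new entry is the larger one and from `U` to `V` if
-- it is the smaller, so both implications are carried through the induction.
order-step : ∀ t U V → InjectiveBelow (suc t) V → rankBelow U t (U t) ≡ rankBelow V t (V t) →
             OrderPreserving t U V → OrderPreserving t V U → OrderPreserving (suc t) U V
order-step t U V inj eq UV VU {p} {q} (s≤s p≤t) (s≤s q≤t) lt with m≤n⇒m<n∨m≡n p≤t | m≤n⇒m<n∨m≡n q≤t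
... | inj₁ p<t  | inj₁ q<t  = UV p<t q<t lt
... | inj₁ p<t  | inj₂ refl = ≰⇒> λ Vt≤Vp → <⇒≱ (rankBelow-strict U t p<t lt) (begin
  rankBelow U t (U t) ≡⟨ eq ⟩
  rankBelow V t (V t) ≤⟨ rankBelow-mono V t Vt≤Vp ⟩
  rankBelow V t (V p) ≤⟨ rankBelow-cong t (λ s<t → VU s<t p<t) ⟩
  rankBelow U t (U p) ∎)
  where open ≤-Reasoning
... | inj₂ refl | inj₁ q<t  = ≰⇒> λ Vq≤Vt →
  <⇒≱ (rankBelow-strict V t q<t (≤∧≢⇒< Vq≤Vt λ Vq≡Vt → <⇒≢ q<t (inj (s≤s q≤t) ≤-refl Vq≡Vt))) (begin
    rankBelow V t (V t) ≡⟨ sym eq ⟩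
    rankBelow U t (U t) ≤⟨ rankBelow-mono U t (<⇒≤ lt) ⟩
    rankBelow U t (U q) ≤⟨ rankBelow-cong t (λ s<t → UV s<t q<t) ⟩
    rankBelow V t (V q) ∎)
  where open ≤-Reasoning
... | inj₂ refl | inj₂ refl = contradiction lt (<-irrefl refl)

code-order : ∀ t U V → InjectiveBelow t U → InjectiveBelow t V → code U t ≡ code V t →
             OrderPreserving t U V × OrderPreserving t V U
code-order zero    U V injU injV eq = (λ ()) , (λ ())
code-order (suc t) U V injU injV eq =
  let UV , VU = code-order t U V (weaken injU) (weaken injV) (cong tail eq)
  in order-step t U V injV (cong head eq) UV VU , order-step t V U injU (sym (cong head eq)) VU UV
  where
  weaken : ∀ {W} → InjectiveBelow (suc t) W → InjectiveBelow t W
  weaken inj p<t q<t = inj (m<n⇒m<1+n p<t) (m<n⇒m<1+n q<t)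

-- The one-line notation of a permutation, with junk value 0 beyond its length.
values : ∀ {n} → S n → ℕ → ℕ
values {n} x t with t <? n
... | yes t<n = toℕ (x ⟨$⟩ʳ fromℕ< t<n)
... | no  _   = 0

values-< : ∀ {n} (x : S n) {t} (t<n : t < n) → values x t ≡ toℕ (x ⟨$⟩ʳ fromℕ< t<n)
values-< {n} x {t} t<n with t <? n
... | yes _   = refl
... | no  t≮n = contradiction t<n t≮n

values-toℕ : ∀ {n} (x : S n) i → values x (toℕ i) ≡ toℕ (x ⟨$⟩ʳ i)
values-toℕ x i = trans (values-< x (toℕ<n i)) (cong (λ k → toℕ (x ⟨$⟩ʳ k)) (fromℕ<-toℕ i (toℕ<n i)))

value-at : ∀ {n} (x : S n) {t} → t < n → Σ (Fin n) λ v → toℕ v ≡ values x t × place x v ≡ t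
value-at x t<n = x ⟨$⟩ʳ fromℕ< t<n , sym (values-< x t<n) , trans (cong toℕ (inverseˡ x)) (toℕ-fromℕ< t<n)

values-injective : ∀ {n} (x : S n) → InjectiveBelow n (values x)
values-injective x p<n q<n eq =
  let v , v≡ , at-p = value-at x p<n
      w , w≡ , at-q = value-at x q<n
  in trans (sym at-p) (trans (cong (place x) (toℕ-injective (trans v≡ (trans eq (sym w≡))))) at-q)

permCode : ∀ {n} → S n → Vec ℕ n
permCode {n} x = code (values x) n

increasing⇒≥ : ∀ {n} (f : Fin n → Fin n) → (∀ {i j} → i <ᶠ j → f i <ᶠ f j) →
               ∀ k i → toℕ i ≡ k → k ≤ toℕ (f i)
increasing⇒≥ f inc zero    i eq = z≤n
increasing⇒≥ {n} f inc (suc k) i eq = ≤-<-trans (increasing⇒≥ f inc k j j≡k) (inc j<i)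
  where
  k<n : k < n
  k<n = <-trans (≤-reflexive (sym eq)) (toℕ<n i)
  j : Fin n
  j = fromℕ< k<n
  j≡k : toℕ j ≡ k
  j≡k = toℕ-fromℕ< k<n
  j<i : j <ᶠ i
  j<i = ≤-reflexive (trans (cong suc j≡k) (sym eq))

-- Equal codes make y ∘ x⁻¹ an increasing self-map of `Fin n`, which never falls below the identity;
-- exchanging `x` and `y` gives equality.
permCode-injective : ∀ {n} (x y : S n) → permCode x ≡ permCode y → x ≈ y
permCode-injective {n} x y eq i =
  toℕ-injective (≤-antisym (increasing x y xy i) (increasing y x yx i))
  where
  both = code-order n (values x) (values y) (values-injective x) (values-injective y) eq
  xy = proj₁ both
  yx = proj₂ both
  increasing : ∀ (u v : S n) → OrderPreserving n (values u) (values v) → ∀ i → toℕ (u ⟨$⟩ʳ i) ≤ toℕ (v ⟨$⟩ʳ i)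
  increasing u v uv i = subst (λ k → toℕ (u ⟨$⟩ʳ i) ≤ toℕ (v ⟨$⟩ʳ k)) (inverseˡ u)
    (increasing⇒≥ (λ a → v ⟨$⟩ʳ (u ⟨$⟩ˡ a)) (λ {a} {b} a<b →
      subst₂ _<_ (values-toℕ v (u ⟨$⟩ˡ a)) (values-toℕ v (u ⟨$⟩ˡ b))
        (uv (toℕ<n (u ⟨$⟩ˡ a)) (toℕ<n (u ⟨$⟩ˡ b))
          (subst₂ _<_ (sym (at a)) (sym (at b)) a<b)))
      (toℕ (u ⟨$⟩ʳ i)) (u ⟨$⟩ʳ i) refl)
    where
    at : ∀ a → values u (toℕ (u ⟨$⟩ˡ a)) ≡ toℕ a
    at a = trans (values-toℕ u (u ⟨$⟩ˡ a)) (cong toℕ (inverseʳ u))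

-- From Eeta wins to avoiding codes, and the final count

module _ {n} (x : S n) (win : EetaWin x) where

  private
    V = values x

    strict : ∀ {p} → suc p < n → V (suc p) ≤ V p → V (suc p) < V p
    strict {p} sp<n le = ≤∧≢⇒< le λ eq → <⇒≢ (n<1+n p) (sym (values-injective x sp<n (<-trans (n<1+n p) sp<n) eq))

    step : ∀ {p a b} → place x a ≡ p → place x b ≡ suc p → place x b ≡ suc (place x a)
    step eqa eqb = trans eqb (cong suc (sym eqa))

  Eeta⇒no-1324 : ∀ t → t < n → ¬ ends1324 (code V (suc t)) ≡ true
  Eeta⇒no-1324 (suc (suc (suc t))) t₃<n bad =
    let t₂<n = <-trans (n<1+n _) t₃<n
        t₁<n = <-trans (n<1+n _) t₂<n
        t₀<n = <-trans (n<1+n _) t₁<n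
        v₀ , e₀ , p₀ = value-at x t₀<n
        v₁ , e₁ , p₁ = value-at x t₁<n
        v₂ , e₂ , p₂ = value-at x t₂<n
        v₃ , e₃ , p₃ = value-at x t₃<n
        v₀<v₂ , v₂≤v₁ , v₁<v₃ = code-1324 V t bad
    in 1324⇒¬Eeta x v₀ v₁ v₂ v₃ (step p₀ p₁) (step p₁ p₂) (step p₂ p₃)
         (subst₂ _<_ (sym e₀) (sym e₂) v₀<v₂) (subst₂ _<_ (sym e₂) (sym e₁) (strict t₂<n v₂≤v₁))
         (subst₂ _<_ (sym e₁) (sym e₃) v₁<v₃) win

  Eeta⇒no-14325 : ∀ t → t < n → ¬ ends14325 (code V (suc t)) ≡ true
  Eeta⇒no-14325 (suc (suc (suc (suc t)))) t₄<n bad =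
    let t₃<n = <-trans (n<1+n _) t₄<n
        t₂<n = <-trans (n<1+n _) t₃<n
        t₁<n = <-trans (n<1+n _) t₂<n
        t₀<n = <-trans (n<1+n _) t₁<n
        v₀ , e₀ , p₀ = value-at x t₀<n
        v₁ , e₁ , p₁ = value-at x t₁<n
        v₂ , e₂ , p₂ = value-at x t₂<n
        v₃ , e₃ , p₃ = value-at x t₃<n
        v₄ , e₄ , p₄ = value-at x t₄<n
        v₀<v₃ , v₃≤v₂ , v₂≤v₁ , v₁<v₄ = code-14325 V t bad
    in 14325⇒¬Eeta x v₀ v₁ v₂ v₃ v₄ (step p₀ p₁) (step p₁ p₂) (step p₂ p₃) (step p₃ p₄)
         (subst₂ _<_ (sym e₀) (sym e₃) v₀<v₃) (subst₂ _<_ (sym e₃) (sym e₂) (strict t₃<n v₃≤v₂))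
         (subst₂ _<_ (sym e₂) (sym e₁) (strict t₂<n v₂≤v₁)) (subst₂ _<_ (sym e₁) (sym e₄) v₁<v₄) win

  Eeta⇒avoids : ∀ t → t ≤ n → avoids (code V t) ≡ true
  Eeta⇒avoids zero    t≤n = refl
  Eeta⇒avoids (suc t) t<n with avoids-∷ (rankBelow V t (V t)) (code V t) (Eeta⇒avoids t (<⇒≤ t<n))
  ... | inj₁ av = av
  ... | inj₂ b with bad⁻ (code V (suc t)) b
  ... | inj₁ e = contradiction e (Eeta⇒no-1324 t t<n)
  ... | inj₂ e = contradiction e (Eeta⇒no-14325 t t<n)

-- Deleting one occurrence of `y` from `zs` costs at least 1 and leaves every other member of `ys`
-- in the list, as these differ from `y`.
length≤∑ : ∀ {A : Set} (f : A → ℕ) ys zs → AllPairs _≢_ ys → (∀ {y} → y ∈ ys → y ∈ zs × 1 ≤ f y) →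
           length ys ≤ ∑ zs f
length≤∑ f []       zs _              sub = z≤n
length≤∑ f (y ∷ ys) zs (y≢ys ∷ uniq) sub with sub (here refl)
... | y∈zs , 1≤fy with ∈-∃++ y∈zs
... | as , bs , refl = begin
  suc (length ys)          ≤⟨ +-mono-≤ 1≤fy (length≤∑ f ys (as ++ bs) uniq sub′) ⟩
  f y + ∑ (as ++ bs) f     ≡⟨ cong (f y +_) (∑-++ as bs f) ⟩
  f y + (∑ as f + ∑ bs f)  ≡⟨ sym (+-assoc (f y) (∑ as f) (∑ bs f)) ⟩
  f y + ∑ as f + ∑ bs f    ≡⟨ cong (_+ ∑ bs f) (+-comm (f y) (∑ as f)) ⟩
  ∑ as f + f y + ∑ bs f    ≡⟨ +-assoc (∑ as f) (f y) (∑ bs f) ⟩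
  ∑ as f + ∑ (y ∷ bs) f    ≡⟨ sym (∑-++ as (y ∷ bs) f) ⟩
  ∑ (as ++ y ∷ bs) f       ∎
  where
  open ≤-Reasoning
  sub′ : ∀ {z} → z ∈ ys → z ∈ as ++ bs × 1 ≤ f z
  sub′ {z} z∈ys with sub (there z∈ys)
  ... | z∈ , 1≤fz with ∈-++⁻ as z∈
  ... | inj₁ z∈as         = ∈-++⁺ˡ z∈as , 1≤fz
  ... | inj₂ (here refl)  = contradiction refl (All.lookup y≢ys z∈ys)
  ... | inj₂ (there z∈bs) = ∈-++⁺ʳ as z∈bs , 1≤fz

EetaWins≤avoiders : ∀ {n} (xs : List (S n)) → DistinctEetaWins xs → length xs ≤ avoiders n
EetaWins≤avoiders {n} xs (distinct , wins) = subst (_≤ avoiders n) (length-map permCode xs)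
  (length≤∑ (λ c → ⟦ avoids c ⟧) (map permCode xs) (codes n)
    (AllPairs.map⁺ (AllPairs.map (λ {u} {v} u≉v eq → u≉v (permCode-injective u v eq)) distinct))
    (λ y∈ → All.lookup (All.map⁺ (All.map (λ {x} win →
      code∈codes (values x) n , ⟦true⟧ (Eeta⇒avoids x win n ≤-refl)) wins)) y∈))

theorem1p4 : ∃₂ λ (C N : ℕ) → ∀ (n : ℕ) → N ≤ n →
    ∀ (xs : List (S n)) → DistinctEetaWins xs →
    length xs * 100000 ^ n ≤ C * 95586 ^ n * n !
theorem1p4 = 100000 ^ 10 , 10 , λ n 10≤n xs wins → bound n (n ∸ 10) (m∸n+n≡m 10≤n) (EetaWins≤avoiders xs wins)
  where
  open ≤-Reasoning
  ratio : ∀ k → 100000 * avoiders (suc k + 10) ≤ 95586 * (suc (k + 10) * avoiders (k + 10))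
  ratio k = subst (λ n → 100000 * avoiders (suc n) ≤ 95586 * (suc n * avoiders n)) (+-comm 10 k) (fine-ratio k)
  -- Only `k` factors 95586/100000 are gained, since length `N` starts from the trivial bound `N !`.
  -- The missing `N` factors are absorbed into the constant 100000 ^ N, using 95586 ^ k ≤ 95586 ^ (k
  -- + N).
  general : ∀ N l k → l * 100000 ^ k ≤ 95586 ^ k * (k + N) ! →
            l * 100000 ^ (k + N) ≤ 100000 ^ N * 95586 ^ (k + N) * (k + N) !
  general N l k le = begin
    l * 100000 ^ (k + N)                        ≡⟨ cong (l *_) (^-distribˡ-+-* 100000 k N) ⟩
    l * (100000 ^ k * 100000 ^ N)               ≡⟨ sym (*-assoc l _ _) ⟩
    l * 100000 ^ k * 100000 ^ N                 ≤⟨ *-monoˡ-≤ (100000 ^ N) le ⟩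
    95586 ^ k * (k + N) ! * 100000 ^ N          ≤⟨ *-monoˡ-≤ (100000 ^ N) (*-monoˡ-≤ ((k + N) !) (^-monoʳ-≤ 95586 (m≤m+n k N))) ⟩
    95586 ^ (k + N) * (k + N) ! * 100000 ^ N    ≡⟨ *-comm _ (100000 ^ N) ⟩
    100000 ^ N * (95586 ^ (k + N) * (k + N) !)  ≡⟨ sym (*-assoc (100000 ^ N) _ _) ⟩
    100000 ^ N * 95586 ^ (k + N) * (k + N) !    ∎
  bound : ∀ n k → k + 10 ≡ n → ∀ {l} → l ≤ avoiders n →
          l * 100000 ^ n ≤ 100000 ^ 10 * 95586 ^ n * n !
  bound _ k refl {l} l≤ = general 10 l k
    (≤-trans (*-monoˡ-≤ (100000 ^ k) l≤) (avoiders-bound 10 ratio k))
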